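{- There are absolute positive constants $C_1,C_2$ such that the following holds. Let $t,d$ be positive integers with $t/30\ge d\ge\lfloor C_1\log t\rfloor$. Let $a_{i,1},a_{i,2}$, $1\le i\le d$, be $2d$ pairwise distinct elements of $\{1,2,\ldots,t\}$, chosen randomly with all choices of $d$ pairwise disjoint pairs being equally likely. Then, with probability at least $1-1/t^2$ (over the choice of the pairs), the chosen pairs have the following property: if for each $i$, $1\le i\le d$, an index $j_i\in\{1,2\}$ is chosen randomly, independently and uniformly, and $Q=\sum_{i=1}^d a_{i,j_i}$, then for every integer $S$ the probability (over the choice of the $j_i$) that $Q=S$ is at most $\frac{C_2}{t d^{1/2}}$. -}

module Defs where

open import Data.Fin.Base using (Fin)
open import Data.Integer.Base using (ℤ; +_; -[1+_])
import Data.Integer.Properties as ℤ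
open import Data.List.Base using (List; []; _∷_; length; filter; map; upTo; allFin; cartesianProductWith)
open import Data.List.Properties using (filter-none)
open import Data.List.Membership.Propositional using (find)
open import Data.List.Relation.Unary.All as All using (All)
open import Data.List.Relation.Unary.All.Properties using (¬Any⇒All¬)
open import Data.List.Relation.Unary.Any using (any?)
open import Data.Nat.Base as ℕ using (ℕ; zero; suc; NonZero)
import Data.Nat.Properties as ℕ
open import Data.Product.Base using (∃; _×_; _,_)
open import Data.Rational.Base
  using (ℚ; mkℚ; 0ℚ; 1ℚ; Positive; _+_; _*_; _÷_; _/_; _≤_; _>_; _<_)
open import Data.Rational.Properties
  using (_≤?_; pos⇒nonZero; <⇒≤; ≤-reflexive; positive⁻¹; pos*pos⇒pos; neg*neg⇒pos; *-zeroˡ; ↥p≡0⇒p≡0; 0/n≡0)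
open import Data.Vec.Base as Vec using (Vec; []; _∷_; concat; lookup; sum; zipWith)
open import Data.Vec.Relation.Unary.AllPairs using (allPairs?)
open import Data.Vec.Relation.Unary.Unique.Propositional using (Unique)
open import Relation.Binary.PropositionalEquality using (_≡_; refl; sym; trans; cong; subst)
open import Relation.Nullary using (yes; no)
open import Relation.Nullary.Decidable using (map′; ¬?)
open import Relation.Unary using (Pred; Decidable; ∁)

ℕ→ℚ : ℕ → ℚ
ℕ→ℚ n = + n / 1

-- Natural logarithm.  For x ≥ 0 the partial sums of Σ xᵏ/k! increase to eˣ,
-- so comparing x with log t amounts to comparing the partial sums with t.

expTerm : ℚ → ℕ → ℚ
expTerm x zero    = 1ℚ
expTerm x (suc k) = expTerm x k * (x * (+ 1 / suc k))

expSum : ℚ → ℕ → ℚ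
expSum x zero    = expTerm x zero
expSum x (suc k) = expSum x k + expTerm x (suc k)

-- For x ≥ 0.
infix 4 _≤log_ _>log_

_≤log_ : ℚ → ℕ → Set
x ≤log t = ∀ k → expSum x k ≤ ℕ→ℚ t

-- For x > 0.  (At x = 0 this still reads 1 > t, i.e. 0 > log t.)
_>log_ : ℚ → ℕ → Set
x >log t = ∃ λ k → expSum x k > ℕ→ℚ t

-- n = ⌊ C log t ⌋, i.e. n / C ≤ log t < (n + 1) / C.
Is⌊_·log_⌋ : (C : ℚ) .{{_ : Positive C}} → ℕ → ℕ → Set
Is⌊ C ·log t ⌋ n =
  (ℕ→ℚ n ÷ C) {{pos⇒nonZero C}} ≤log t ×
  (ℕ→ℚ (suc n) ÷ C) {{pos⇒nonZero C}} >log t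

-- p ≤ c / √ d, for p, c ≥ 0 and d > 0, with the square root cleared by squaring.
infix 4 _≤_/√_
_≤_/√_ : ℚ → ℚ → ℕ → Set
p ≤ c /√ d = (p * p) * ℕ→ℚ d ≤ c * c

-- Probability of P for a uniformly random entry of the list (0 on the empty
-- list).  The lists used below have no repeated entries.
Pr : ∀ {a p} {A : Set a} (Ω : List A) {P : Pred A p} → Decidable P → ℚ
Pr []            P? = 0ℚ
Pr Ω@(_ ∷ Ω′) P? = + length (filter P? Ω) / suc (length Ω′)

vectors : ∀ {a} {A : Set a} → List A → (n : ℕ) → List (Vec A n)
vectors xs zero    = [] ∷ []
vectors xs (suc n) = cartesianProductWith _∷_ xs (vectors xs n)

-- Row i is (a_{i,1} , a_{i,2}).
Pairs : ℕ → Set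
Pairs d = Vec (Vec ℕ 2) d

unique? : ∀ {n} → Decidable (Unique {A = ℕ} {n})
unique? = allPairs? (λ x y → ¬? (x ℕ.≟ y))

-- All families whose 2d entries are pairwise distinct elements of {1,…,t}.
-- Each set of d disjoint unordered pairs arises from exactly 2ᵈ d! of them.
disjointPairs : (t d : ℕ) → List (Pairs d)
disjointPairs t d =
  filter (λ a → unique? (concat a)) (vectors (vectors (map suc (upTo t)) 2) d)

Choice : ℕ → Set
Choice d = Vec (Fin 2) d

choices : (d : ℕ) → List (Choice d)
choices d = vectors (allFin 2) d

Q : ∀ {d} → Pairs d → Choice d → ℤ
Q a j = + sum (zipWith lookup a j)

Spread : ∀ (C : ℚ) (t d : ℕ) .{{_ : NonZero t}} → Pairs d → Set
Spread C t d a =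
  ∀ (S : ℤ) → Pr (choices d) (λ j → Q a j ℤ.≟ S) ≤ C * (+ 1 / t) /√ d

-- Spread is decidable, because only the attained values S need to be tested.

private
  0≤q*q : ∀ q → 0ℚ ≤ q * q
  0≤q*q q@(mkℚ (+ zero) _ _)  = ≤-reflexive (sym (trans (cong (_* q) (↥p≡0⇒p≡0 q refl)) (*-zeroˡ q)))
  0≤q*q q@(mkℚ (+ suc _) _ _) = <⇒≤ (positive⁻¹ (q * q) {{pos*pos⇒pos q q}})
  0≤q*q q@(mkℚ -[1+ _ ] _ _)  = <⇒≤ (positive⁻¹ (q * q) {{neg*neg⇒pos q q}})

  Pr-none : ∀ {a p} {A : Set a} (Ω : List A) {P : Pred A p} (P? : Decidable P) →
            All (∁ P) Ω → Pr Ω P? ≡ 0ℚ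
  Pr-none []            P? _    = refl
  Pr-none Ω@(_ ∷ Ω′) P? none =
    trans (cong (λ xs → + length xs / suc (length Ω′)) (filter-none P? none))
          (0/n≡0 (suc (length Ω′)))

  0≤c/√d : ∀ {p} c d → p ≡ 0ℚ → p ≤ c /√ d
  0≤c/√d c d refl = subst (_≤ c * c) (sym (*-zeroˡ (ℕ→ℚ d))) (0≤q*q c)

spread? : ∀ C t d .{{_ : NonZero t}} → Decidable (Spread C t d)
spread? C t d a = map′ to (λ spread → All.tabulate (λ {j} _ → spread (Q a j)))
                       (All.all? (λ j → bound? (Q a j)) (choices d))
  where
  Bound : ℤ → Set
  Bound S = Pr (choices d) (λ j → Q a j ℤ.≟ S) ≤ C * (+ 1 / t) /√ d

  bound? : Decidable Bound
  bound? S = _ ≤? _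

  to : All (λ j → Bound (Q a j)) (choices d) → ∀ S → Bound S
  to all S with any? (λ j → Q a j ℤ.≟ S) (choices d)
  ... | yes S∈ with find S∈
  ...   | j , j∈ , refl = All.lookup all j∈
  to all S | no S∉ =
    0≤c/√d (C * (+ 1 / t)) d (Pr-none (choices d) _ (¬Any⇒All¬ _ S∉))

{-# OPTIONS --safe #-}

-- Deal the d pairs alternately into two halves.  The energy of a half, i.e. the
-- number of pairs of choices in it with equal sums, bounds the number of choices
-- of all pairs with a given sum (Cauchy–Schwarz), so it suffices that both
-- energies are at most of order 4^(d/2) / (t √d).
--
-- Adding the pair (a , b) to a half turns its energy X into 2 X + 2 R(a , b),
-- where R(a , b) ≤ X counts coincidences between the sums shifted by a and by b.
-- Averaged over a, b ≤ t, R is at most t⁻¹ 2ᵏ times the number of sums in an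
-- interval of length t.  Once order d of the k differences |a − b| are of order
-- t, this is at most of order 4ᵏ / (t √d), by Littlewood–Offord.  So a step is bad
-- (|a − b| small or R far above its average) with small probability 1 / K whatever
-- happened before, and each other late step halves the excess of X / 4ᵏ over
-- order 1 / (t √d).  At most d / 8 bad steps suffice for the energy bound.
--
-- The expectation of K^(number of bad steps) over independent uniform pairs is at
-- most 2ᵈ, and disjointness has probability at least 2⁻ᵈ; as K^(d / 8) is much
-- larger than 4ᵈ t² when d ≥ C₁ log t, more than d / 8 steps are bad with
-- probability at most 1 / t².

module Submission where

-- The operators of ℕ are opened only in this module, those of ℚ after it.
module _ where

  open import Defs
  open import Data.Bool.Base using (if_then_else_)
  open import Data.Empty using (⊥-elim)
  import Data.Fin.Base as Fin
  import Data.Integer.Base as ℤ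
  import Data.Integer.Properties as ℤ
  open import Data.Integer.Tactic.RingSolver using () renaming (solve-∀ to solve-∀ℤ)
  open import Data.List.Base using (List; []; _∷_; _++_; allFin; applyUpTo; cartesianProductWith; filter; length; map; upTo)
  open import Data.List.Membership.Propositional using (_∈_)
  open import Data.List.Membership.Propositional.Properties using (∈-∃++)
  open import Data.List.Properties using (length-++; length-map; length-upTo; map-++; map-cong; map-∘)
  open import Data.List.Relation.Unary.All as All using (All; []; _∷_)
  import Data.List.Relation.Unary.All.Properties as All
  open import Data.List.Relation.Unary.AllPairs as AllPairs using (AllPairs; []; _∷_)
  import Data.List.Relation.Unary.AllPairs.Properties as AllPairs
  open import Data.List.Relation.Unary.Any using (any?; here; there)
  open import Data.List.Relation.Unary.Unique.Propositional using () renaming (Unique to UniqueList)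
  open import Data.List.Relation.Unary.Unique.Propositional.Properties using (map⁺; upTo⁺)
  open import Data.Nat.Base
  open import Data.Nat.DivMod using (m%n<n; m/n*n≤m; m≡m%n+[m/n]*n; m≥n⇒m/n>0)
  open import Data.Nat.ListAction using (sum)
  open import Data.Nat.ListAction.Properties using (sum-++)
  open import Data.Nat.Properties
  open import Data.Nat.Tactic.RingSolver using (solve-∀)
  open import Data.Product.Base using (_,_; _×_; proj₁; proj₂; ∃)
  open import Data.Rational.Base as ℚ using (0ℚ; 1ℚ; NonNegative; Positive; toℚᵘ; ℚ)
  import Data.Rational.Properties as ℚ
  open import Data.Rational.Solver using (module +-*-Solver)
  open import Data.Rational.Unnormalised.Base as ℚᵘ using (mkℚᵘ)
  import Data.Rational.Unnormalised.Properties as ℚᵘ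
  open import Data.Sum.Base using (_⊎_; inj₁; inj₂)
  open import Data.Vec.Base as Vec using (Vec; []; _∷_; concat; lookup; toList; zipWith)
  open import Data.Vec.Properties using (length-toList)
  import Data.Vec.Relation.Unary.All as VecAll
  open import Data.Vec.Relation.Unary.AllPairs using ([]; _∷_)
  open import Data.Vec.Relation.Unary.Unique.Propositional using (Unique)
  open import Function.Base using (_∘_; const; id)
  open import Level using (0ℓ)
  open import Relation.Binary.Definitions using (DecidableEquality)
  open import Relation.Binary.PropositionalEquality
  open import Relation.Nullary using (¬_; Dec; does; no; yes)
  open import Relation.Nullary.Decidable using (_×-dec_; _⊎-dec_; ¬?)
  open import Relation.Unary using (Decidable; Pred)

  2*m*n≤m²+n² : ∀ m n → 2 * m * n ≤ m * m + n * n
  2*m*n≤m²+n² m n with ≤-total m n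
  ... | inj₁ m≤n with k ← n ∸ m | refl ← sym (m+[n∸m]≡n m≤n) = ≤-trans (m≤m+n _ (k * k)) (≤-reflexive (lemma m k))
    where
    lemma : ∀ m k → 2 * m * (m + k) + k * k ≡ m * m + (m + k) * (m + k)
    lemma = solve-∀
  ... | inj₂ n≤m with k ← m ∸ n | refl ← sym (m+[n∸m]≡n n≤m) = ≤-trans (m≤m+n _ (k * k)) (≤-reflexive (lemma n k))
    where
    lemma : ∀ n k → 2 * (n + k) * n + k * k ≡ (n + k) * (n + k) + n * n
    lemma = solve-∀

  ^-distribʳ-* : ∀ k m n → (m * n) ^ k ≡ m ^ k * n ^ k
  ^-distribʳ-* zero    m n = refl
  ^-distribʳ-* (suc k) m n rewrite ^-distribʳ-* k m n = lemma m n (m ^ k) (n ^ k)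
    where
    lemma : ∀ m n p q → m * n * (p * q) ≡ m * p * (n * q)
    lemma = solve-∀

  n<2^n : ∀ n → n < 2 ^ n
  n<2^n zero    = s≤s z≤n
  n<2^n (suc n) = ≤-trans (+-mono-≤ (m^n>0 2 n) (n<2^n n)) (≤-reflexive (cong (2 ^ n +_) (sym (+-identityʳ (2 ^ n)))))

  private variable
    A B : Set
    P P′ : Set

  -- Opaque, so that 𝟙 (m ≟ n) does not unfold to a test on m ≡ᵇ n.
  opaque
    𝟙 : Dec P → ℕ
    𝟙 p = if does p then 1 else 0

    𝟙≤1 : (p : Dec P) → 𝟙 p ≤ 1
    𝟙≤1 (yes _) = ≤-refl
    𝟙≤1 (no _)  = z≤n

    𝟙-yes : (p : Dec P) → P → 𝟙 p ≡ 1
    𝟙-yes (yes _) _ = refl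
    𝟙-yes (no ¬p) p = ⊥-elim (¬p p)

    𝟙-no : (p : Dec P) → ¬ P → 𝟙 p ≡ 0
    𝟙-no (yes p) ¬p = ⊥-elim (¬p p)
    𝟙-no (no _)  _  = refl

    𝟙-mono : (p : Dec P) (p′ : Dec P′) → (P → P′) → 𝟙 p ≤ 𝟙 p′
    𝟙-mono (no _)  p′ f = z≤n
    𝟙-mono (yes p) p′ f = ≤-reflexive (sym (𝟙-yes p′ (f p)))

    𝟙-cong : (p : Dec P) (p′ : Dec P′) → (P → P′) → (P′ → P) → 𝟙 p ≡ 𝟙 p′
    𝟙-cong p p′ f g = ≤-antisym (𝟙-mono p p′ f) (𝟙-mono p′ p g)

  *𝟙≤ : ∀ c {n} (p : Dec P) → (P → c ≤ n) → c * 𝟙 p ≤ n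
  *𝟙≤ c (yes p) c≤n = ≤-trans (≤-reflexive (trans (cong (c *_) (𝟙-yes (yes p) p)) (*-identityʳ c))) (c≤n p)
  *𝟙≤ c (no ¬p) _   = ≤-trans (≤-reflexive (trans (cong (c *_) (𝟙-no (no ¬p) ¬p)) (*-zeroʳ c))) z≤n

  𝟙≤ : ∀ {n} (p : Dec P) → (P → 1 ≤ n) → 𝟙 p ≤ n
  𝟙≤ p 1≤n = ≤-trans (≤-reflexive (sym (*-identityˡ _))) (*𝟙≤ 1 p 1≤n)

  ∑ : List A → (A → ℕ) → ℕ
  ∑ xs f = sum (map f xs)

  ∑-cong : ∀ (xs : List A) {f g} → (∀ x → f x ≡ g x) → ∑ xs f ≡ ∑ xs g
  ∑-cong xs f≗g = cong sum (map-cong f≗g xs)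

  ∑-mono : ∀ (xs : List A) {f g} → (∀ x → f x ≤ g x) → ∑ xs f ≤ ∑ xs g
  ∑-mono []       f≤g = z≤n
  ∑-mono (x ∷ xs) f≤g = +-mono-≤ (f≤g x) (∑-mono xs f≤g)

  ∑-++ : ∀ (xs ys : List A) f → ∑ (xs ++ ys) f ≡ ∑ xs f + ∑ ys f
  ∑-++ xs ys f = trans (cong sum (map-++ f xs ys)) (sum-++ (map f xs) (map f ys))

  ∑-map : ∀ (g : A → B) xs f → ∑ (map g xs) f ≡ ∑ xs (f ∘ g)
  ∑-map g xs f = cong sum (sym (map-∘ xs))

  ∑-+ : ∀ (xs : List A) f g → ∑ xs (λ x → f x + g x) ≡ ∑ xs f + ∑ xs g
  ∑-+ []       f g = refl
  ∑-+ (x ∷ xs) f g rewrite ∑-+ xs f g = lemma (f x) (g x) (∑ xs f) (∑ xs g)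
    where
    lemma : ∀ a b c d → a + b + (c + d) ≡ a + c + (b + d)
    lemma = solve-∀

  ∑-*ˡ : ∀ (xs : List A) c f → ∑ xs (λ x → c * f x) ≡ c * ∑ xs f
  ∑-*ˡ []       c f = sym (*-zeroʳ c)
  ∑-*ˡ (x ∷ xs) c f rewrite ∑-*ˡ xs c f = sym (*-distribˡ-+ c (f x) (∑ xs f))

  ∑-*ʳ : ∀ (xs : List A) c f → ∑ xs (λ x → f x * c) ≡ ∑ xs f * c
  ∑-*ʳ xs c f = trans (∑-cong xs (λ x → *-comm (f x) c)) (trans (∑-*ˡ xs c f) (*-comm c _))

  ∑-const : ∀ (xs : List A) c → ∑ xs (const c) ≡ length xs * c
  ∑-const []       c = refl
  ∑-const (x ∷ xs) c = cong (c +_) (∑-const xs c)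

  ∑-zero : ∀ (xs : List A) {f} → (∀ x → f x ≡ 0) → ∑ xs f ≡ 0
  ∑-zero xs f≗0 = trans (∑-cong xs f≗0) (trans (∑-const xs 0) (*-zeroʳ (length xs)))

  ∑-swap : ∀ (xs : List A) (ys : List B) (f : A → B → ℕ) →
           ∑ xs (λ x → ∑ ys (λ y → f x y)) ≡ ∑ ys (λ y → ∑ xs (λ x → f x y))
  ∑-swap []       ys f = sym (∑-zero ys (λ _ → refl))
  ∑-swap (x ∷ xs) ys f rewrite ∑-swap xs ys f = sym (∑-+ ys (f x) (λ y → ∑ xs (λ x → f x y)))

  ∑-cartesianProductWith : ∀ {C : Set} (h : A → B → C) xs ys (f : C → ℕ) →
    ∑ (cartesianProductWith h xs ys) f ≡ ∑ xs (λ x → ∑ ys (λ y → f (h x y)))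
  ∑-cartesianProductWith h []       ys f = refl
  ∑-cartesianProductWith h (x ∷ xs) ys f = begin
    ∑ (map (h x) ys ++ cartesianProductWith h xs ys) f
      ≡⟨ ∑-++ (map (h x) ys) _ f ⟩
    ∑ (map (h x) ys) f + ∑ (cartesianProductWith h xs ys) f
      ≡⟨ cong₂ _+_ (∑-map (h x) ys f) (∑-cartesianProductWith h xs ys f) ⟩
    ∑ ys (f ∘ h x) + ∑ xs (λ x → ∑ ys (λ y → f (h x y))) ∎
    where open ≡-Reasoning

  length-filter-∑ : ∀ {P : Pred A _} (P? : Decidable P) xs → length (filter P? xs) ≡ ∑ xs (𝟙 ∘ P?)
  length-filter-∑ P? []       = refl
  length-filter-∑ P? (x ∷ xs) with P? x
  ... | yes p = cong₂ _+_ (sym (𝟙-yes (yes p) p)) (length-filter-∑ P? xs)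
  ... | no ¬p = cong₂ _+_ (sym (𝟙-no (no ¬p) ¬p)) (length-filter-∑ P? xs)

  ∑-filter : ∀ {P : Pred A _} (P? : Decidable P) xs f → ∑ (filter P? xs) f ≡ ∑ xs (λ x → 𝟙 (P? x) * f x)
  ∑-filter P? []       f = refl
  ∑-filter P? (x ∷ xs) f with P? x
  ... | yes p = cong₂ _+_ (sym (trans (cong (_* f x) (𝟙-yes (yes p) p)) (*-identityˡ (f x)))) (∑-filter P? xs f)
  ... | no ¬p = cong₂ _+_ (sym (cong (_* f x) (𝟙-no (no ¬p) ¬p))) (∑-filter P? xs f)

  ∑-applyUpTo : ∀ (h : ℕ → A) n f → ∑ (applyUpTo h n) f ≡ ∑ (upTo n) (f ∘ h)
  ∑-applyUpTo h zero    f = refl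
  ∑-applyUpTo h (suc n) f = cong (f (h 0) +_)
    (trans (∑-applyUpTo (h ∘ suc) n f) (sym (∑-applyUpTo suc n (f ∘ h))))

  ∑-upTo-+ : ∀ m n f → ∑ (upTo (m + n)) f ≡ ∑ (upTo m) f + ∑ (upTo n) (λ i → f (m + i))
  ∑-upTo-+ zero    n f = refl
  ∑-upTo-+ (suc m) n f = begin
    f 0 + ∑ (applyUpTo suc (m + n)) f
      ≡⟨ cong (f 0 +_) (∑-applyUpTo suc (m + n) f) ⟩
    f 0 + ∑ (upTo (m + n)) (f ∘ suc)
      ≡⟨ cong (f 0 +_) (∑-upTo-+ m n (f ∘ suc)) ⟩
    f 0 + (∑ (upTo m) (f ∘ suc) + ∑ (upTo n) (λ i → f (suc m + i)))
      ≡⟨ +-assoc (f 0) _ _ ⟨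
    f 0 + ∑ (upTo m) (f ∘ suc) + ∑ (upTo n) (λ i → f (suc m + i))
      ≡⟨ cong (λ z → f 0 + z + ∑ (upTo n) (λ i → f (suc m + i))) (∑-applyUpTo suc m f) ⟨
    ∑ (upTo (suc m)) f + ∑ (upTo n) (λ i → f (suc m + i)) ∎
    where open ≡-Reasoning

  ∑-upTo-* : ∀ J n f → ∑ (upTo (J * n)) f ≡ ∑ (upTo J) (λ i → ∑ (upTo n) (λ j → f (i * n + j)))
  ∑-upTo-* zero    n f = refl
  ∑-upTo-* (suc J) n f = begin
    ∑ (upTo (n + J * n)) f
      ≡⟨ ∑-upTo-+ n (J * n) f ⟩
    ∑ (upTo n) f + ∑ (upTo (J * n)) (λ k → f (n + k))
      ≡⟨ cong (∑ (upTo n) f +_) (∑-upTo-* J n (λ k → f (n + k))) ⟩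
    ∑ (upTo n) f + ∑ (upTo J) (λ i → ∑ (upTo n) (λ j → f (n + (i * n + j))))
      ≡⟨ cong (∑ (upTo n) f +_) (∑-cong (upTo J) λ i → ∑-cong (upTo n) λ j → cong f (sym (+-assoc n (i * n) j))) ⟩
    ∑ (upTo n) f + ∑ (upTo J) (λ i → ∑ (upTo n) (λ j → f (suc i * n + j)))
      ≡⟨ cong (∑ (upTo n) f +_) (∑-applyUpTo suc J _) ⟨
    ∑ (upTo (suc J)) (λ i → ∑ (upTo n) (λ j → f (i * n + j))) ∎
    where open ≡-Reasoning

  ∑-upTo-mono : ∀ {m n} f → m ≤ n → ∑ (upTo m) f ≤ ∑ (upTo n) f
  ∑-upTo-mono {m} {n} f m≤n = begin
    ∑ (upTo m) f                                          ≤⟨ m≤m+n _ _ ⟩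
    ∑ (upTo m) f + ∑ (upTo (n ∸ m)) (λ i → f (m + i))     ≡⟨ ∑-upTo-+ m (n ∸ m) f ⟨
    ∑ (upTo (m + (n ∸ m))) f                              ≡⟨ cong (λ k → ∑ (upTo k) f) (m+[n∸m]≡n m≤n) ⟩
    ∑ (upTo n) f                                          ∎
    where open ≤-Reasoning

  ∑-𝟙≡≤1 : {f : ℕ → ℕ} → (∀ {x y} → f x ≡ f y → x ≡ y) → ∀ {xs} → UniqueList xs →
            ∀ c → ∑ xs (λ x → 𝟙 (f x ≟ c)) ≤ 1
  ∑-𝟙≡≤1 inj [] c = z≤n
  ∑-𝟙≡≤1 {f} inj {x ∷ xs} (x∉ ∷ u) c with f x ≟ c in eq
  ... | no  ≢c   = ≤-trans (≤-reflexive (cong (_+ ∑ xs _) (𝟙-no (no ≢c) ≢c))) (∑-𝟙≡≤1 inj u c)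
  ... | yes refl = +-mono-≤ (𝟙≤1 (yes refl)) (≤-reflexive (none x∉))
    where
    none : ∀ {x xs} → All (x ≢_) xs → ∑ xs (λ y → 𝟙 (f y ≟ f x)) ≡ 0
    none []         = refl
    none {x} {y ∷ _} (x≢ ∷ ps) = cong₂ _+_ (𝟙-no (f y ≟ f x) (x≢ ∘ sym ∘ inj)) (none ps)

  module _ {K : Set} (_≟ₖ_ : DecidableEquality K) where

    coincidences : List K → List K → ℕ
    coincidences xs ys = ∑ xs λ x → ∑ ys λ y → 𝟙 (x ≟ₖ y)

    coincidences-comm : ∀ xs ys → coincidences xs ys ≡ coincidences ys xs
    coincidences-comm xs ys = trans (∑-swap xs ys (λ x y → 𝟙 (x ≟ₖ y)))
      (∑-cong ys λ y → ∑-cong xs λ x → 𝟙-cong (x ≟ₖ y) (y ≟ₖ x) sym sym)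

    private
      ∷-∷ : ∀ z xs ys → coincidences (z ∷ xs) (z ∷ ys) ≡
            1 + ∑ ys (λ y → 𝟙 (z ≟ₖ y)) + ∑ xs (λ x → 𝟙 (z ≟ₖ x)) + coincidences xs ys
      ∷-∷ z xs ys = begin
        𝟙 (z ≟ₖ z) + ∑ ys (λ y → 𝟙 (z ≟ₖ y)) + ∑ xs (λ x → 𝟙 (x ≟ₖ z) + ∑ ys (λ y → 𝟙 (x ≟ₖ y)))
          ≡⟨ cong₂ (λ i j → i + ∑ ys (λ y → 𝟙 (z ≟ₖ y)) + j) (𝟙-yes (z ≟ₖ z) refl) (∑-+ xs (λ x → 𝟙 (x ≟ₖ z)) _) ⟩
        1 + ∑ ys (λ y → 𝟙 (z ≟ₖ y)) + (∑ xs (λ x → 𝟙 (x ≟ₖ z)) + coincidences xs ys)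
          ≡⟨ +-assoc (1 + ∑ ys (λ y → 𝟙 (z ≟ₖ y))) _ _ ⟨
        1 + ∑ ys (λ y → 𝟙 (z ≟ₖ y)) + ∑ xs (λ x → 𝟙 (x ≟ₖ z)) + coincidences xs ys
          ≡⟨ cong (λ i → 1 + ∑ ys (λ y → 𝟙 (z ≟ₖ y)) + i + coincidences xs ys)
               (∑-cong xs λ x → 𝟙-cong (x ≟ₖ z) (z ≟ₖ x) sym sym) ⟩
        1 + ∑ ys (λ y → 𝟙 (z ≟ₖ y)) + ∑ xs (λ x → 𝟙 (z ≟ₖ x)) + coincidences xs ys ∎
        where open ≡-Reasoning

      ∑-shift : ∀ (f : K → ℕ) ys z zs → ∑ (ys ++ z ∷ zs) f ≡ ∑ (z ∷ ys ++ zs) f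
      ∑-shift f ys z zs rewrite ∑-++ ys (z ∷ zs) f | ∑-++ ys zs f = lemma (∑ ys f) (f z) (∑ zs f)
        where
        lemma : ∀ a b c → a + (b + c) ≡ b + (a + c)
        lemma = solve-∀

      none : ∀ {x} ys → ¬ x ∈ ys → ∑ ys (λ y → 𝟙 (x ≟ₖ y)) ≡ 0
      none         []       x∉ = refl
      none {x} (y ∷ ys) x∉ = cong₂ _+_ (𝟙-no (x ≟ₖ y) (x∉ ∘ here)) (none ys (x∉ ∘ there))

    -- With the multiplicities c and c′ of xs and ys this is
    -- 2 Σ c(k)c′(k) ≤ Σ c(k)² + Σ c′(k)²; common entries are cancelled one by one.
    2*coincidences≤ : ∀ xs ys → 2 * coincidences xs ys ≤ coincidences xs xs + coincidences ys ys
    2*coincidences≤ []       ys = z≤n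
    2*coincidences≤ (x ∷ xs) ys with any? (x ≟ₖ_) ys
    ... | no x∉ = begin
      2 * coincidences (x ∷ xs) ys
        ≡⟨ cong (λ i → 2 * (i + coincidences xs ys)) (none ys x∉) ⟩
      2 * coincidences xs ys
        ≤⟨ 2*coincidences≤ xs ys ⟩
      coincidences xs xs + coincidences ys ys
        ≤⟨ +-monoˡ-≤ _ (≤-trans (m≤n+m _ _) (≤-reflexive (sym (∷-∷ x xs xs)))) ⟩
      coincidences (x ∷ xs) (x ∷ xs) + coincidences ys ys ∎
      where open ≤-Reasoning
    ... | yes x∈ with ∈-∃++ x∈
    ... | ys₁ , ys₂ , refl = begin
      2 * coincidences (x ∷ xs) (ys₁ ++ x ∷ ys₂)
        ≡⟨ cong (2 *_) (∑-cong (x ∷ xs) λ z → ∑-shift _ ys₁ x ys₂) ⟩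
      2 * coincidences (x ∷ xs) (x ∷ zs)
        ≡⟨ cong (2 *_) (∷-∷ x xs zs) ⟩
      2 * (1 + ∑ zs _ + ∑ xs _ + coincidences xs zs)
        ≡⟨ *-distribˡ-+ 2 (1 + ∑ zs _ + ∑ xs _) _ ⟩
      2 * (1 + ∑ zs _ + ∑ xs _) + 2 * coincidences xs zs
        ≤⟨ +-monoʳ-≤ (2 * (1 + ∑ zs _ + ∑ xs _)) (2*coincidences≤ xs zs) ⟩
      2 * (1 + ∑ zs _ + ∑ xs _) + (coincidences xs xs + coincidences zs zs)
        ≡⟨ lemma (∑ zs _) (∑ xs _) (coincidences xs xs) (coincidences zs zs) ⟩
      1 + ∑ xs _ + ∑ xs _ + coincidences xs xs + (1 + ∑ zs _ + ∑ zs _ + coincidences zs zs)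
        ≡⟨ cong₂ _+_ (∷-∷ x xs xs) (∷-∷ x zs zs) ⟨
      coincidences (x ∷ xs) (x ∷ xs) + coincidences (x ∷ zs) (x ∷ zs)
        ≡⟨ cong (coincidences (x ∷ xs) (x ∷ xs) +_)
             (trans (∑-shift _ ys₁ x ys₂) (∑-cong (x ∷ zs) λ z → ∑-shift _ ys₁ x ys₂)) ⟨
      coincidences (x ∷ xs) (x ∷ xs) + coincidences (ys₁ ++ x ∷ ys₂) (ys₁ ++ x ∷ ys₂) ∎
      where
      zs = ys₁ ++ ys₂
      open ≤-Reasoning
      lemma : ∀ a b c d → 2 * (1 + a + b) + (c + d) ≡ 1 + b + b + c + (1 + a + a + d)
      lemma = solve-∀

  Row : Set
  Row = ℕ × ℕ

  sums : List Row → List ℕ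
  sums []            = 0 ∷ []
  sums ((a , b) ∷ u) = map (a +_) (sums u) ++ map (b +_) (sums u)

  ∑-sums-∷ : ∀ a b u f → ∑ (sums ((a , b) ∷ u)) f ≡ ∑ (sums u) (λ σ → f (a + σ)) + ∑ (sums u) (λ σ → f (b + σ))
  ∑-sums-∷ a b u f = trans (∑-++ (map (a +_) (sums u)) _ f)
    (cong₂ _+_ (∑-map (a +_) (sums u) f) (∑-map (b +_) (sums u) f))

  length-sums : ∀ u → length (sums u) ≡ 2 ^ length u
  length-sums []            = refl
  length-sums ((a , b) ∷ u) = begin
    length (map (a +_) (sums u) ++ map (b +_) (sums u))
      ≡⟨ length-++ (map (a +_) (sums u)) ⟩
    length (map (a +_) (sums u)) + length (map (b +_) (sums u))
      ≡⟨ cong₂ _+_ (length-map (a +_) (sums u)) (length-map (b +_) (sums u)) ⟩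
    length (sums u) + length (sums u)
      ≡⟨ cong₂ _+_ (length-sums u) (trans (length-sums u) (sym (+-identityʳ _))) ⟩
    2 ^ suc (length u) ∎
    where open ≡-Reasoning

  -- Energy

  shiftedEnergy : List Row → ℕ → ℕ → ℕ
  shiftedEnergy u a b = coincidences _≟_ (map (a +_) (sums u)) (map (b +_) (sums u))

  energy : List Row → ℕ
  energy u = coincidences _≟_ (sums u) (sums u)

  coincidences-map : ∀ {A K : Set} (_≟ₖ_ : DecidableEquality K) (f g : A → K) xs ys →
    coincidences _≟ₖ_ (map f xs) (map g ys) ≡ ∑ xs (λ x → ∑ ys (λ y → 𝟙 (f x ≟ₖ g y)))
  coincidences-map _≟ₖ_ f g xs ys =
    trans (∑-map f xs _) (∑-cong xs λ x → ∑-map g ys _)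

  coincidences-injective : ∀ {A K : Set} (_≟_ : DecidableEquality A) (_≟ₖ_ : DecidableEquality K) {f : A → K} →
    (∀ {x y} → f x ≡ f y → x ≡ y) → ∀ xs ys →
    coincidences _≟ₖ_ (map f xs) (map f ys) ≡ coincidences _≟_ xs ys
  coincidences-injective _≟_ _≟ₖ_ {f} inj xs ys = trans (coincidences-map _≟ₖ_ f f xs ys)
    (∑-cong xs λ x → ∑-cong ys λ y → 𝟙-cong (f x ≟ₖ f y) (x ≟ y) inj (cong f))

  shiftedEnergy-diagonal : ∀ u a → shiftedEnergy u a a ≡ energy u
  shiftedEnergy-diagonal u a = coincidences-injective _≟_ _≟_ (+-cancelˡ-≡ a _ _) (sums u) (sums u)

  shiftedEnergy≤energy : ∀ u a b → shiftedEnergy u a b ≤ energy u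
  shiftedEnergy≤energy u a b = *-cancelˡ-≤ 2 (begin
    2 * shiftedEnergy u a b
      ≤⟨ 2*coincidences≤ _≟_ (map (a +_) (sums u)) (map (b +_) (sums u)) ⟩
    shiftedEnergy u a a + shiftedEnergy u b b
      ≡⟨ cong₂ _+_ (shiftedEnergy-diagonal u a) (trans (shiftedEnergy-diagonal u b) (sym (+-identityʳ _))) ⟩
    2 * energy u ∎)
    where open ≤-Reasoning

  energy-∷ : ∀ a b u → energy ((a , b) ∷ u) ≡ 2 * (energy u + shiftedEnergy u a b)
  energy-∷ a b u = begin
    ∑ (xs ++ ys) (λ z → ∑ (xs ++ ys) (λ z′ → 𝟙 (z ≟ z′)))
      ≡⟨ ∑-cong (xs ++ ys) (λ z → ∑-++ xs ys (λ z′ → 𝟙 (z ≟ z′))) ⟩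
    ∑ (xs ++ ys) (λ z → ∑ xs (λ z′ → 𝟙 (z ≟ z′)) + ∑ ys (λ z′ → 𝟙 (z ≟ z′)))
      ≡⟨ ∑-+ (xs ++ ys) _ _ ⟩
    coincidences _≟_ (xs ++ ys) xs + coincidences _≟_ (xs ++ ys) ys
      ≡⟨ cong₂ _+_ (∑-++ xs ys _) (∑-++ xs ys _) ⟩
    coincidences _≟_ xs xs + coincidences _≟_ ys xs + (coincidences _≟_ xs ys + coincidences _≟_ ys ys)
      ≡⟨ cong₂ _+_
           (cong₂ _+_ (shiftedEnergy-diagonal u a) (coincidences-comm _≟_ ys xs))
           (cong (coincidences _≟_ xs ys +_) (shiftedEnergy-diagonal u b)) ⟩
    energy u + shiftedEnergy u a b + (shiftedEnergy u a b + energy u)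
      ≡⟨ lemma (energy u) (shiftedEnergy u a b) ⟩
    2 * (energy u + shiftedEnergy u a b) ∎
    where
    open ≡-Reasoning
    xs = map (a +_) (sums u)
    ys = map (b +_) (sums u)
    lemma : ∀ e r → e + r + (r + e) ≡ 2 * (e + r)
    lemma = solve-∀

  energy-∷≤ : ∀ x u → energy (x ∷ u) ≤ 4 * energy u
  energy-∷≤ (a , b) u = begin
    energy ((a , b) ∷ u)                    ≡⟨ energy-∷ a b u ⟩
    2 * (energy u + shiftedEnergy u a b)    ≤⟨ *-monoʳ-≤ 2 (+-monoʳ-≤ (energy u) (shiftedEnergy≤energy u a b)) ⟩
    2 * (energy u + energy u)               ≡⟨ lemma (energy u) ⟩
    4 * energy u                            ∎
    where
    open ≤-Reasoning
    lemma : ∀ e → 2 * (e + e) ≡ 4 * e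
    lemma = solve-∀

  energy≤4^ : ∀ u → energy u ≤ 4 ^ length u
  energy≤4^ []      = ≤-reflexive (trans (+-identityʳ _) (trans (+-identityʳ _) (𝟙-yes (0 ≟ 0) refl)))
  energy≤4^ (x ∷ u) = ≤-trans (energy-∷≤ x u) (*-monoʳ-≤ 4 (energy≤4^ u))

  2*convolution≤energy : ∀ u v n →
    2 * ∑ (sums u) (λ σ → ∑ (sums v) (λ τ → 𝟙 (σ + τ ≟ n))) ≤ energy u + energy v
  2*convolution≤energy u v n = begin
    2 * ∑ (sums u) (λ σ → ∑ (sums v) (λ τ → 𝟙 (σ + τ ≟ n)))
      ≡⟨ cong (2 *_) (∑-cong (sums u) λ σ → ∑-cong (sums v) λ τ →
           𝟙-cong (σ + τ ≟ n) (ℤ.+ σ ℤ.≟ n⊖ τ) (to σ τ) (from σ τ)) ⟩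
    2 * ∑ (sums u) (λ σ → ∑ (sums v) (λ τ → 𝟙 (ℤ.+ σ ℤ.≟ n⊖ τ)))
      ≡⟨ cong (2 *_) (coincidences-map ℤ._≟_ (ℤ.+_) n⊖ (sums u) (sums v)) ⟨
    2 * coincidences ℤ._≟_ (map ℤ.+_ (sums u)) (map n⊖ (sums v))
      ≤⟨ 2*coincidences≤ ℤ._≟_ (map ℤ.+_ (sums u)) (map n⊖ (sums v)) ⟩
    coincidences ℤ._≟_ (map ℤ.+_ (sums u)) (map ℤ.+_ (sums u)) + coincidences ℤ._≟_ (map n⊖ (sums v)) (map n⊖ (sums v))
      ≡⟨ cong₂ _+_
           (coincidences-injective _≟_ ℤ._≟_ ℤ.+-injective (sums u) (sums u))
           (coincidences-injective _≟_ ℤ._≟_ n⊖-injective (sums v) (sums v)) ⟩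
    energy u + energy v ∎
    where
    open ≤-Reasoning
    n⊖ : ℕ → ℤ.ℤ
    n⊖ τ = ℤ.+ n ℤ.- ℤ.+ τ
    involutive : ∀ i j → j ≡ i ℤ.- (i ℤ.- j)
    involutive = solve-∀ℤ
    n⊖-injective : ∀ {τ τ′} → n⊖ τ ≡ n⊖ τ′ → τ ≡ τ′
    n⊖-injective {τ} {τ′} eq = ℤ.+-injective (trans (involutive (ℤ.+ n) (ℤ.+ τ))
      (trans (cong (λ z → ℤ.+ n ℤ.- z) eq) (sym (involutive (ℤ.+ n) (ℤ.+ τ′)))))
    cancel : ∀ i j → i ≡ i ℤ.+ j ℤ.- j
    cancel = solve-∀ℤ
    uncancel : ∀ i j → i ℤ.- j ℤ.+ j ≡ i
    uncancel = solve-∀ℤ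
    to : ∀ σ τ → σ + τ ≡ n → ℤ.+ σ ≡ n⊖ τ
    to σ τ refl = cancel (ℤ.+ σ) (ℤ.+ τ)
    from : ∀ σ τ → ℤ.+ σ ≡ n⊖ τ → σ + τ ≡ n
    from σ τ eq = ℤ.+-injective (trans (cong (ℤ._+ ℤ.+ τ) eq) (uncancel (ℤ.+ n) (ℤ.+ τ)))

  -- Random walks absorbed at 0

  step : (ℕ → ℕ) → ℕ → ℕ
  step φ zero    = 0
  step φ (suc r) = φ r + φ (2 + r)

  -- 2ᵐ times the expectation of φ at time m for the simple random walk started
  -- at r and absorbed at 0 (for φ 0 = 0).
  walk : ℕ → (ℕ → ℕ) → ℕ → ℕ
  walk zero    φ = φ
  walk (suc m) φ = walk m (step φ)

  step-mono : ∀ {φ ψ} → (∀ r → φ r ≤ ψ r) → ∀ r → step φ r ≤ step ψ r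
  step-mono φ≤ψ zero    = z≤n
  step-mono φ≤ψ (suc r) = +-mono-≤ (φ≤ψ r) (φ≤ψ (2 + r))

  walk-mono : ∀ m {φ ψ} → (∀ r → φ r ≤ ψ r) → ∀ r → walk m φ r ≤ walk m ψ r
  walk-mono zero    φ≤ψ = φ≤ψ
  walk-mono (suc m) φ≤ψ = walk-mono m (step-mono φ≤ψ)

  walk-cong : ∀ m {φ ψ} → (∀ r → φ r ≡ ψ r) → ∀ r → walk m φ r ≡ walk m ψ r
  walk-cong m φ≗ψ r = ≤-antisym (walk-mono m (≤-reflexive ∘ φ≗ψ) r) (walk-mono m (≤-reflexive ∘ sym ∘ φ≗ψ) r)

  step-linear : ∀ a b φ ψ r → step (λ r → a * φ r + b * ψ r) r ≡ a * step φ r + b * step ψ r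
  step-linear a b φ ψ zero    = sym (cong₂ _+_ (*-zeroʳ a) (*-zeroʳ b))
  step-linear a b φ ψ (suc r) = lemma a b (φ r) (φ (2 + r)) (ψ r) (ψ (2 + r))
    where
    lemma : ∀ a b x x′ y y′ → a * x + b * y + (a * x′ + b * y′) ≡ a * (x + x′) + b * (y + y′)
    lemma = solve-∀

  walk-linear : ∀ m a b φ ψ r → walk m (λ r → a * φ r + b * ψ r) r ≡ a * walk m φ r + b * walk m ψ r
  walk-linear zero    a b φ ψ r = refl
  walk-linear (suc m) a b φ ψ r = trans (walk-cong m (step-linear a b φ ψ) r) (walk-linear m a b (step φ) (step ψ) r)

  walk-suc : ∀ m φ r → walk (suc m) φ r ≡ step (walk m φ) r
  walk-suc zero    φ r = refl
  walk-suc (suc m) φ r = walk-suc m (step φ) r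

  positive : ℕ → ℕ
  positive zero    = 0
  positive (suc _) = 1

  square cube : ℕ → ℕ
  square r = r * r
  cube r   = r * r * r

  walk-id : ∀ m r → walk m id r ≡ 2 ^ m * r
  walk-id zero    r = sym (+-identityʳ r)
  walk-id (suc m) r = begin
    walk m (step id) r                   ≡⟨ walk-cong m step-id r ⟩
    walk m (λ r → 2 * r + 0 * r) r       ≡⟨ walk-linear m 2 0 id id r ⟩
    2 * walk m id r + 0                  ≡⟨ cong (λ x → 2 * x + 0) (walk-id m r) ⟩
    2 * (2 ^ m * r) + 0                  ≡⟨ lemma (2 ^ m) r ⟩
    2 * 2 ^ m * r                        ∎
    where
    open ≡-Reasoning
    step-id : ∀ r → step id r ≡ 2 * r + 0 * r
    step-id zero    = refl
    step-id (suc r) = lemma′ r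
      where
      lemma′ : ∀ r → r + (2 + r) ≡ 2 * (1 + r) + 0
      lemma′ = solve-∀
    lemma : ∀ p r → 2 * (p * r) + 0 ≡ 2 * p * r
    lemma = solve-∀

  walk-cube : ∀ m r → walk m cube r ≡ 2 ^ m * (cube r + 3 * m * r)
  walk-cube zero    r = lemma (cube r)
    where
    lemma : ∀ x → x ≡ 1 * (x + 0)
    lemma = solve-∀
  walk-cube (suc m) r = begin
    walk m (step cube) r                            ≡⟨ walk-cong m step-cube r ⟩
    walk m (λ r → 2 * cube r + 6 * r) r             ≡⟨ walk-linear m 2 6 cube id r ⟩
    2 * walk m cube r + 6 * walk m id r             ≡⟨ cong₂ (λ x y → 2 * x + 6 * y) (walk-cube m r) (walk-id m r) ⟩
    2 * (2 ^ m * (cube r + 3 * m * r)) + 6 * (2 ^ m * r)  ≡⟨ lemma (2 ^ m) m r (cube r) ⟩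
    2 * 2 ^ m * (cube r + 3 * (1 + m) * r)              ∎
    where
    open ≡-Reasoning
    step-cube : ∀ r → step cube r ≡ 2 * cube r + 6 * r
    step-cube zero    = refl
    step-cube (suc r) = lemma′ r
      where
      lemma′ : ∀ r → r * r * r + (2 + r) * (2 + r) * (2 + r) ≡ 2 * ((1 + r) * (1 + r) * (1 + r)) + 6 * (1 + r)
      lemma′ = solve-∀
    lemma : ∀ p m r c → 2 * (p * (c + 3 * m * r)) + 6 * (p * r) ≡ 2 * p * (c + 3 * (1 + m) * r)
    lemma = solve-∀

  m*walk-positive≤walk-square : ∀ m r → m * walk m positive r ≤ walk m square r
  m*walk-positive≤walk-square zero    r = z≤n
  m*walk-positive≤walk-square (suc m) r = begin
    suc m * walk m (step positive) r
      ≤⟨ *-monoʳ-≤ (suc m) (walk-mono m step-positive r) ⟩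
    suc m * walk m (λ r → 2 * positive r + 0 * r) r
      ≡⟨ cong (suc m *_) (walk-linear m 2 0 positive id r) ⟩
    suc m * (2 * walk m positive r + 0)
      ≡⟨ lemma m (walk m positive r) ⟩
    2 * (m * walk m positive r) + 2 * walk m positive r
      ≤⟨ +-monoˡ-≤ _ (*-monoʳ-≤ 2 (m*walk-positive≤walk-square m r)) ⟩
    2 * walk m square r + 2 * walk m positive r
      ≡⟨ walk-linear m 2 2 square positive r ⟨
    walk m (λ r → 2 * square r + 2 * positive r) r
      ≡⟨ walk-cong m step-square r ⟨
    walk m (step square) r ∎
    where
    open ≤-Reasoning
    step-positive : ∀ r → step positive r ≤ 2 * positive r + 0 * r
    step-positive zero          = z≤n
    step-positive (suc zero)    = s≤s z≤n
    step-positive (suc (suc r)) = ≤-refl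
    step-square : ∀ r → step square r ≡ 2 * square r + 2 * positive r
    step-square zero    = refl
    step-square (suc r) = lemma′ r
      where
      lemma′ : ∀ r → r * r + (2 + r) * (2 + r) ≡ 2 * ((1 + r) * (1 + r)) + 2
      lemma′ = solve-∀
    lemma : ∀ m w → (1 + m) * (2 * w + 0) ≡ 2 * (m * w) + 2 * w
    lemma = solve-∀

  -- The first three moments of the absorbed walk are explicit enough to bound
  -- the survival probability: 2 s r² ≤ s² r + r³.
  survival-bound : ∀ s m → s * s ≤ m → s * walk m positive 1 ≤ 3 * 2 ^ m
  survival-bound zero    m     _    = z≤n
  survival-bound s@(suc _) m@(suc _) s²≤m = *-cancelˡ-≤ (2 * m) (begin
    2 * m * (s * walk m positive 1)
      ≡⟨ lemma₁ m s (walk m positive 1) ⟩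
    2 * s * (m * walk m positive 1)
      ≤⟨ *-monoʳ-≤ (2 * s) (m*walk-positive≤walk-square m 1) ⟩
    2 * s * walk m square 1
      ≡⟨ +-identityʳ _ ⟨
    2 * s * walk m square 1 + 0 * walk m square 1
      ≡⟨ walk-linear m (2 * s) 0 square square 1 ⟨
    walk m (λ r → 2 * s * square r + 0 * square r) 1
      ≤⟨ walk-mono m pointwise 1 ⟩
    walk m (λ r → s * s * r + 1 * cube r) 1
      ≡⟨ walk-linear m (s * s) 1 id cube 1 ⟩
    s * s * walk m id 1 + 1 * walk m cube 1
      ≡⟨ cong₂ (λ x y → s * s * x + 1 * y) (walk-id m 1) (walk-cube m 1) ⟩
    s * s * (2 ^ m * 1) + 1 * (2 ^ m * (1 + 3 * m * 1))
      ≡⟨ lemma₂ (s * s) (2 ^ m) m ⟩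
    2 ^ m * (s * s + 1 + 3 * m)
      ≤⟨ *-monoʳ-≤ (2 ^ m) (+-monoˡ-≤ (3 * m) (+-mono-≤ s²≤m (s≤s z≤n))) ⟩
    2 ^ m * (m + m + 3 * m)
      ≤⟨ *-monoʳ-≤ (2 ^ m) (≤-trans (m≤m+n _ m) (≤-reflexive (lemma₃ m))) ⟩
    2 ^ m * (6 * m)
      ≡⟨ lemma₄ (2 ^ m) m ⟩
    2 * m * (3 * 2 ^ m) ∎)
    where
    open ≤-Reasoning
    lemma₁ : ∀ m s w → 2 * m * (s * w) ≡ 2 * s * (m * w)
    lemma₁ = solve-∀
    lemma₂ : ∀ q p m → q * (p * 1) + 1 * (p * (1 + 3 * m * 1)) ≡ p * (q + 1 + 3 * m)
    lemma₂ = solve-∀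
    lemma₃ : ∀ m → m + m + 3 * m + m ≡ 6 * m
    lemma₃ = solve-∀
    lemma₄ : ∀ p m → p * (6 * m) ≡ 2 * m * (3 * p)
    lemma₄ = solve-∀
    lemma₅ : ∀ s r → 2 * s * (r * r) + 0 ≡ 2 * s * r * r
    lemma₅ = solve-∀
    lemma₆ : ∀ q r → (q + r * r) * r ≡ q * r + 1 * (r * r * r)
    lemma₆ = solve-∀
    pointwise : ∀ r → 2 * s * square r + 0 * square r ≤ s * s * r + 1 * cube r
    pointwise r = begin
      2 * s * (r * r) + 0             ≡⟨ lemma₅ s r ⟩
      2 * s * r * r                   ≤⟨ *-monoˡ-≤ r (2*m*n≤m²+n² s r) ⟩
      (s * s + r * r) * r             ≡⟨ lemma₆ (s * s) r ⟩
      s * s * r + 1 * cube r          ∎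

  -- Littlewood–Offord

  module Separation (δ : ℕ) where

    Separated : Row → Set
    Separated (a , b) = a + δ ≤ b ⊎ b + δ ≤ a

    separated? : Decidable Separated
    separated? (a , b) = (a + δ ≤? b) ⊎-dec (b + δ ≤? a)

    separatedCount unseparatedCount : List Row → ℕ
    separatedCount u   = ∑ u (𝟙 ∘ separated?)
    unseparatedCount u = ∑ u (𝟙 ∘ ¬? ∘ separated?)

    separated+unseparated : ∀ u → separatedCount u + unseparatedCount u ≡ length u
    separated+unseparated u = begin
      separatedCount u + unseparatedCount u
        ≡⟨ ∑-+ u _ _ ⟨
      ∑ u (λ x → 𝟙 (separated? x) + 𝟙 (¬? (separated? x)))
        ≡⟨ ∑-cong u one ⟩
      ∑ u (const 1)
        ≡⟨ trans (∑-const u 1) (*-identityʳ _) ⟩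
      length u ∎
      where
      open ≡-Reasoning
      one : ∀ x → 𝟙 (separated? x) + 𝟙 (¬? (separated? x)) ≡ 1
      one x with separated? x
      ... | yes p = cong₂ _+_ (𝟙-yes (yes p) p) (𝟙-no (¬? (yes p)) (λ ¬p → ¬p p))
      ... | no ¬p = cong₂ _+_ (𝟙-no (no ¬p) ¬p) (𝟙-yes (¬? (no ¬p)) ¬p)

    Spaced : List ℕ → Set
    Spaced = AllPairs (λ y y′ → y + δ ≤ y′)

    Spaced-shift : ∀ c {ys} → Spaced ys → Spaced (map (_+ c) ys)
    Spaced-shift c = AllPairs.map⁺ ∘ AllPairs.map λ {y} {y′} y+δ≤y′ →
      ≤-trans (≤-reflexive (lemma y c δ)) (+-monoˡ-≤ c y+δ≤y′)
      where
      lemma : ∀ y c δ → y + c + δ ≡ y + δ + c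
      lemma = solve-∀

    -- The indicator of a half-open interval of length at most δ has this property.
    record IsWindow (w : ℕ → ℕ) : Set where
      field
        atMostOne : ∀ z → w z ≤ 1
        exclusive : ∀ {z z′} → z + δ ≤ z′ → w z + w z′ ≤ 1

    windowSum : (ℕ → ℕ) → List Row → List ℕ → ℕ
    windowSum w u ys = ∑ ys λ y → ∑ (sums u) λ σ → w (y + σ)

    windowSum-∷ : ∀ w a b u ys →
      windowSum w ((a , b) ∷ u) ys ≡ windowSum w u (map (_+ a) ys) + windowSum w u (map (_+ b) ys)
    windowSum-∷ w a b u ys = begin
      windowSum w ((a , b) ∷ u) ys
        ≡⟨ ∑-cong ys (λ y → ∑-sums-∷ a b u (λ σ → w (y + σ))) ⟩
      ∑ ys (λ y → ∑ (sums u) (λ σ → w (y + (a + σ))) + ∑ (sums u) (λ σ → w (y + (b + σ))))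
        ≡⟨ ∑-+ ys _ _ ⟩
      ∑ ys (λ y → ∑ (sums u) (λ σ → w (y + (a + σ)))) + ∑ ys (λ y → ∑ (sums u) (λ σ → w (y + (b + σ))))
        ≡⟨ cong₂ _+_ (shift a) (shift b) ⟩
      windowSum w u (map (_+ a) ys) + windowSum w u (map (_+ b) ys) ∎
      where
      open ≡-Reasoning
      shift : ∀ c → ∑ ys (λ y → ∑ (sums u) (λ σ → w (y + (c + σ)))) ≡ windowSum w u (map (_+ c) ys)
      shift c = trans (∑-cong ys λ y → ∑-cong (sums u) λ σ → cong w (sym (+-assoc y c σ)))
        (sym (∑-map (_+ c) ys _))

    -- For a separated row (a , b) the least point, shifted by a, is moved from
    -- the first family of intervals to the second, which keeps both families
    -- spaced and changes their sizes from r, r to r − 1, r + 1.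
    windowSum-bound : ∀ {w} → IsWindow w → ∀ u {ys} → Spaced ys →
      windowSum w u ys ≤ 2 ^ unseparatedCount u * walk (separatedCount u) positive (length ys)
    windowSum-bound {w} W [] {ys} sp = ≤-trans (base sp) (≤-reflexive (sym (+-identityʳ _)))
      where
      open IsWindow W
      vanish : ∀ {y ys} → w (y + 0) ≡ 1 → All (λ y′ → y + δ ≤ y′) ys → windowSum w [] ys ≡ 0
      vanish w≡1 [] = refl
      vanish {y} {y′ ∷ _} w≡1 (y≤ ∷ ys≤) = cong₂ _+_
        (trans (+-identityʳ _) (n≤0⇒n≡0 (+-cancelˡ-≤ 1 _ _ (subst (λ i → i + w (y′ + 0) ≤ 1) w≡1
          (exclusive (subst₂ (λ i j → i + δ ≤ j) (sym (+-identityʳ y)) (sym (+-identityʳ y′)) y≤))))))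
        (vanish w≡1 ys≤)
      base : ∀ {ys} → Spaced ys → windowSum w [] ys ≤ positive (length ys)
      base [] = z≤n
      base {y ∷ ys} (y≤ ∷ sp) with w (y + 0) in eq | atMostOne (y + 0)
      ... | 0 | _ = ≤-trans (base sp) (positive≤1 (length ys))
        where
        positive≤1 : ∀ n → positive n ≤ 1
        positive≤1 zero    = z≤n
        positive≤1 (suc _) = ≤-refl
      ... | 1 | _ = ≤-reflexive (cong suc (vanish eq y≤))
      ... | suc (suc _) | s≤s ()
    windowSum-bound {w} W (x@(a , b) ∷ u) {ys} sp with separated? x
    ... | no ¬s = begin
      windowSum w (x ∷ u) ys
        ≡⟨ windowSum-∷ w a b u ys ⟩
      windowSum w u (map (_+ a) ys) + windowSum w u (map (_+ b) ys)
        ≤⟨ +-mono-≤ (bound a) (bound b) ⟩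
      2 ^ n * walk m positive (length ys) + 2 ^ n * walk m positive (length ys)
        ≡⟨ lemma (2 ^ n) (walk m positive (length ys)) ⟩
      2 ^ suc n * walk m positive (length ys)
        ≡⟨ cong₂ (λ i j → 2 ^ (i + n) * walk (j + m) positive (length ys)) (𝟙-yes (¬? (no ¬s)) ¬s) (𝟙-no (no ¬s) ¬s) ⟨
      2 ^ (𝟙 (¬? (no ¬s)) + n) * walk (𝟙 (no ¬s) + m) positive (length ys) ∎
      where
      open ≤-Reasoning
      n = unseparatedCount u
      m = separatedCount u
      bound : ∀ c → windowSum w u (map (_+ c) ys) ≤ 2 ^ n * walk m positive (length ys)
      bound c = subst (λ l → windowSum w u (map (_+ c) ys) ≤ 2 ^ n * walk m positive l) (length-map (_+ c) ys)
        (windowSum-bound W u (Spaced-shift c sp))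
      lemma : ∀ p q → p * q + p * q ≡ 2 * p * q
      lemma = solve-∀
    ... | yes s = begin
      windowSum w (x ∷ u) ys
        ≤⟨ main ys sp ⟩
      2 ^ n * walk (suc m) positive (length ys)
        ≡⟨ cong₂ (λ i j → 2 ^ (i + n) * walk (j + m) positive (length ys)) (𝟙-no (¬? (yes s)) (λ ¬s → ¬s s)) (𝟙-yes (yes s) s) ⟨
      2 ^ (𝟙 (¬? (yes s)) + n) * walk (𝟙 (yes s) + m) positive (length ys) ∎
      where
      open ≤-Reasoning
      n = unseparatedCount u
      m = separatedCount u
      bound : ∀ {zs} l → Spaced zs → length zs ≡ l → windowSum w u zs ≤ 2 ^ n * walk m positive l
      bound l sp refl = windowSum-bound W u sp
      swap : ∀ p q r → p + q + r ≡ q + (p + r)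
      swap = solve-∀
      rearrange : ∀ c d → c + δ ≤ d → ∀ y ys → Spaced (y ∷ ys) →
        windowSum w u (map (_+ c) (y ∷ ys)) + windowSum w u (map (_+ d) (y ∷ ys)) ≤ 2 ^ n * walk (suc m) positive (suc (length ys))
      rearrange c d c+δ≤d y ys (y≤ ∷ sp) = begin
        windowSum w u (map (_+ c) (y ∷ ys)) + windowSum w u (map (_+ d) (y ∷ ys))
          ≡⟨ swap (∑ (sums u) (λ σ → w (y + c + σ))) (windowSum w u (map (_+ c) ys)) _ ⟩
        windowSum w u (map (_+ c) ys) + windowSum w u (y + c ∷ map (_+ d) (y ∷ ys))
          ≤⟨ +-mono-≤ (bound (length ys) (Spaced-shift c sp) (length-map _ ys))
                      (bound (2 + length ys) (first ∷ Spaced-shift d (y≤ ∷ sp)) (cong (2 +_) (length-map _ ys))) ⟩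
        2 ^ n * walk m positive (length ys) + 2 ^ n * walk m positive (2 + length ys)
          ≡⟨ *-distribˡ-+ (2 ^ n) _ _ ⟨
        2 ^ n * step (walk m positive) (suc (length ys))
          ≡⟨ cong (2 ^ n *_) (walk-suc m positive (suc (length ys))) ⟨
        2 ^ n * walk (suc m) positive (suc (length ys)) ∎
        where
        y+c+δ≤y+d : y + c + δ ≤ y + d
        y+c+δ≤y+d = ≤-trans (≤-reflexive (+-assoc y c δ)) (+-monoʳ-≤ y c+δ≤d)
        first : All (λ z → y + c + δ ≤ z) (map (_+ d) (y ∷ ys))
        first = y+c+δ≤y+d ∷ All.map⁺ (All.map (λ {z} y+δ≤z → ≤-trans y+c+δ≤y+d
          (+-monoˡ-≤ d (≤-trans (m≤m+n y δ) y+δ≤z))) y≤)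
      main : ∀ ys → Spaced ys → windowSum w (x ∷ u) ys ≤ 2 ^ n * walk (suc m) positive (length ys)
      main []       sp = z≤n
      main (y ∷ ys) sp = ≤-trans (≤-reflexive (windowSum-∷ w a b u (y ∷ ys))) (helper s)
        where
        helper : Separated x → windowSum w u (map (_+ a) (y ∷ ys)) + windowSum w u (map (_+ b) (y ∷ ys)) ≤ 2 ^ n * walk (suc m) positive (suc (length ys))
        helper (inj₁ a+δ≤b) = rearrange a b a+δ≤b y ys sp
        helper (inj₂ b+δ≤a) = ≤-trans (≤-reflexive (+-comm (windowSum w u (map (_+ a) (y ∷ ys))) _)) (rearrange b a b+δ≤a y ys sp)

    littlewood-offord : ∀ {w} → IsWindow w → ∀ s u → s * s ≤ separatedCount u → ∀ y →
      s * ∑ (sums u) (λ σ → w (y + σ)) ≤ 3 * 2 ^ length u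
    littlewood-offord {w} W s u s²≤ y = begin
      s * ∑ (sums u) (λ σ → w (y + σ))
        ≡⟨ cong (s *_) (+-identityʳ _) ⟨
      s * windowSum w u (y ∷ [])
        ≤⟨ *-monoʳ-≤ s (windowSum-bound W u ([] ∷ [])) ⟩
      s * (2 ^ unseparatedCount u * walk (separatedCount u) positive 1)
        ≡⟨ lemma₁ s (2 ^ unseparatedCount u) _ ⟩
      2 ^ unseparatedCount u * (s * walk (separatedCount u) positive 1)
        ≤⟨ *-monoʳ-≤ (2 ^ unseparatedCount u) (survival-bound s (separatedCount u) s²≤) ⟩
      2 ^ unseparatedCount u * (3 * 2 ^ separatedCount u)
        ≡⟨ lemma₂ (2 ^ unseparatedCount u) (2 ^ separatedCount u) ⟩
      3 * (2 ^ separatedCount u * 2 ^ unseparatedCount u)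
        ≡⟨ cong (3 *_) (^-distribˡ-+-* 2 (separatedCount u) (unseparatedCount u)) ⟨
      3 * 2 ^ (separatedCount u + unseparatedCount u)
        ≡⟨ cong (λ k → 3 * 2 ^ k) (separated+unseparated u) ⟩
      3 * 2 ^ length u ∎
      where
      open ≤-Reasoning
      lemma₁ : ∀ s p q → s * (p * q) ≡ p * (s * q)
      lemma₁ = solve-∀
      lemma₂ : ∀ p q → p * (3 * q) ≡ 3 * (q * p)
      lemma₂ = solve-∀

    interval : ℕ → ℕ → ℕ
    interval S z = 𝟙 ((z <? S) ×-dec (S ≤? z + δ))

    interval-isWindow : ∀ S → IsWindow (interval S)
    interval-isWindow S = record { atMostOne = λ z → 𝟙≤1 (inside? z) ; exclusive = exclusive }
      where
      inside? : ∀ z → Dec (z < S × S ≤ z + δ)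
      inside? z = (z <? S) ×-dec (S ≤? z + δ)
      exclusive : ∀ {z z′} → z + δ ≤ z′ → 𝟙 (inside? z) + 𝟙 (inside? z′) ≤ 1
      exclusive {z} {z′} z+δ≤z′ with inside? z
      ... | no ¬p = +-mono-≤ (≤-reflexive (𝟙-no (no ¬p) ¬p)) (𝟙≤1 (inside? z′))
      ... | yes p = +-mono-≤ (𝟙≤1 (yes p)) (≤-reflexive (𝟙-no (inside? z′)
        λ (z′<S , _) → <-irrefl refl (<-≤-trans z′<S (≤-trans (proj₂ p) z+δ≤z′))))

    ∑-𝟙≤interval : ∀ S z → ∑ (upTo δ) (λ j → 𝟙 (suc j + z ≟ S)) ≤ interval S z
    ∑-𝟙≤interval S z with (z <? S) ×-dec (S ≤? z + δ)
    ... | yes p = ≤-trans (∑-𝟙≡≤1 (suc-injective ∘ +-cancelʳ-≡ z _ _) (upTo⁺ δ) S)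
      (≤-reflexive (sym (𝟙-yes (yes p) p)))
    ... | no ¬p = ≤-trans (≤-reflexive (vanish (λ j → j) δ (λ i<δ → i<δ))) z≤n
      where
      vanish : ∀ (h : ℕ → ℕ) n → (∀ {i} → i < n → h i < δ) → ∑ (applyUpTo h n) (λ j → 𝟙 (suc j + z ≟ S)) ≡ 0
      vanish h zero    h<δ = refl
      vanish h (suc n) h<δ = cong₂ _+_
        (𝟙-no (suc (h 0) + z ≟ S) λ { refl → ¬p (s≤s (m≤n+m z (h 0)) , ≤-trans (≤-reflexive (+-comm (suc (h 0)) z)) (+-monoʳ-≤ z (h<δ (s≤s z≤n)))) })
        (vanish (h ∘ suc) n (h<δ ∘ s≤s))

    concentration : ∀ J t s u → t ≤ J * δ → s * s ≤ separatedCount u → ∀ S →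
      s * ∑ (upTo t) (λ b → ∑ (sums u) (λ σ → 𝟙 (suc b + σ ≟ S))) ≤ J * (3 * 2 ^ length u)
    concentration J t s u t≤Jδ s²≤ S = begin
      s * ∑ (upTo t) (λ b → ∑ (sums u) (λ σ → 𝟙 (suc b + σ ≟ S)))
        ≤⟨ *-monoʳ-≤ s (∑-upTo-mono _ t≤Jδ) ⟩
      s * ∑ (upTo (J * δ)) (λ b → ∑ (sums u) (λ σ → 𝟙 (suc b + σ ≟ S)))
        ≡⟨ cong (s *_) (∑-upTo-* J δ _) ⟩
      s * ∑ (upTo J) (λ i → ∑ (upTo δ) (λ j → ∑ (sums u) (λ σ → 𝟙 (suc (i * δ + j) + σ ≟ S))))
        ≡⟨ ∑-*ˡ (upTo J) s _ ⟨
      ∑ (upTo J) (λ i → s * ∑ (upTo δ) (λ j → ∑ (sums u) (λ σ → 𝟙 (suc (i * δ + j) + σ ≟ S))))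
        ≤⟨ ∑-mono (upTo J) block ⟩
      ∑ (upTo J) (const (3 * 2 ^ length u))
        ≡⟨ ∑-const (upTo J) _ ⟩
      length (upTo J) * (3 * 2 ^ length u)
        ≡⟨ cong (_* (3 * 2 ^ length u)) (length-upTo J) ⟩
      J * (3 * 2 ^ length u) ∎
      where
      open ≤-Reasoning
      lemma : ∀ i j σ → 1 + (i + j) + σ ≡ 1 + j + (i + σ)
      lemma = solve-∀
      block : ∀ i → s * ∑ (upTo δ) (λ j → ∑ (sums u) (λ σ → 𝟙 (suc (i * δ + j) + σ ≟ S))) ≤ 3 * 2 ^ length u
      block i = begin
        s * ∑ (upTo δ) (λ j → ∑ (sums u) (λ σ → 𝟙 (suc (i * δ + j) + σ ≟ S)))
          ≡⟨ cong (s *_) (∑-swap (upTo δ) (sums u) (λ j σ → 𝟙 (suc (i * δ + j) + σ ≟ S))) ⟩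
        s * ∑ (sums u) (λ σ → ∑ (upTo δ) (λ j → 𝟙 (suc (i * δ + j) + σ ≟ S)))
          ≡⟨ cong (s *_) (∑-cong (sums u) λ σ → ∑-cong (upTo δ) λ j → cong (λ z → 𝟙 (z ≟ S)) (lemma (i * δ) j σ)) ⟩
        s * ∑ (sums u) (λ σ → ∑ (upTo δ) (λ j → 𝟙 (suc j + (i * δ + σ) ≟ S)))
          ≤⟨ *-monoʳ-≤ s (∑-mono (sums u) λ σ → ∑-𝟙≤interval S (i * δ + σ)) ⟩
        s * ∑ (sums u) (λ σ → interval S (i * δ + σ))
          ≤⟨ littlewood-offord (interval-isWindow S) s u s²≤ (i * δ) ⟩
        3 * 2 ^ length u ∎

    ∑-shiftedEnergy : ∀ J t s u → t ≤ J * δ → s * s ≤ separatedCount u →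
      s * ∑ (upTo t) (λ a → ∑ (upTo t) (λ b → shiftedEnergy u (suc a) (suc b))) ≤ t * (3 * J * 4 ^ length u)
    ∑-shiftedEnergy J t s u t≤Jδ s²≤ = begin
      s * ∑ (upTo t) (λ a → ∑ (upTo t) (λ b → shiftedEnergy u (suc a) (suc b)))
        ≡⟨ ∑-*ˡ (upTo t) s _ ⟨
      ∑ (upTo t) (λ a → s * ∑ (upTo t) (λ b → shiftedEnergy u (suc a) (suc b)))
        ≤⟨ ∑-mono (upTo t) row ⟩
      ∑ (upTo t) (const (3 * J * 4 ^ length u))
        ≡⟨ ∑-const (upTo t) _ ⟩
      length (upTo t) * (3 * J * 4 ^ length u)
        ≡⟨ cong (_* (3 * J * 4 ^ length u)) (length-upTo t) ⟩
      t * (3 * J * 4 ^ length u) ∎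
      where
      open ≤-Reasoning
      lemma : ∀ J p → p * (J * (3 * p)) ≡ 3 * J * (p * p)
      lemma = solve-∀
      2^*2^ : ∀ k → 2 ^ k * 2 ^ k ≡ 4 ^ k
      2^*2^ k = sym (^-distribʳ-* k 2 2)
      row : ∀ a → s * ∑ (upTo t) (λ b → shiftedEnergy u (suc a) (suc b)) ≤ 3 * J * 4 ^ length u
      row a = begin
        s * ∑ (upTo t) (λ b → shiftedEnergy u (suc a) (suc b))
          ≡⟨ cong (s *_) (∑-cong (upTo t) λ b → coincidences-map _≟_ (suc a +_) (suc b +_) (sums u) (sums u)) ⟩
        s * ∑ (upTo t) (λ b → ∑ (sums u) (λ σ → ∑ (sums u) (λ τ → 𝟙 (suc a + σ ≟ suc b + τ))))
          ≡⟨ cong (s *_) (∑-swap (upTo t) (sums u) (λ b σ → ∑ (sums u) (λ τ → 𝟙 (suc a + σ ≟ suc b + τ)))) ⟩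
        s * ∑ (sums u) (λ σ → ∑ (upTo t) (λ b → ∑ (sums u) (λ τ → 𝟙 (suc a + σ ≟ suc b + τ))))
          ≡⟨ ∑-*ˡ (sums u) s _ ⟨
        ∑ (sums u) (λ σ → s * ∑ (upTo t) (λ b → ∑ (sums u) (λ τ → 𝟙 (suc a + σ ≟ suc b + τ))))
          ≡⟨ ∑-cong (sums u) (λ σ → cong (s *_) (∑-cong (upTo t) λ b → ∑-cong (sums u) λ τ →
               𝟙-cong (suc a + σ ≟ suc b + τ) (suc b + τ ≟ suc a + σ) sym sym)) ⟩
        ∑ (sums u) (λ σ → s * ∑ (upTo t) (λ b → ∑ (sums u) (λ τ → 𝟙 (suc b + τ ≟ suc a + σ))))
          ≤⟨ ∑-mono (sums u) (λ σ → concentration J t s u t≤Jδ s²≤ (suc a + σ)) ⟩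
        ∑ (sums u) (const (J * (3 * 2 ^ length u)))
          ≡⟨ ∑-const (sums u) _ ⟩
        length (sums u) * (J * (3 * 2 ^ length u))
          ≡⟨ cong (_* (J * (3 * 2 ^ length u))) (length-sums u) ⟩
        2 ^ length u * (J * (3 * 2 ^ length u))
          ≡⟨ lemma J (2 ^ length u) ⟩
        3 * J * (2 ^ length u * 2 ^ length u)
          ≡⟨ cong (3 * J *_) (2^*2^ (length u)) ⟩
        3 * J * 4 ^ length u ∎

  few-unseparated : ∀ δ a t → ∑ (upTo t) (λ b → 𝟙 (¬? (Separation.separated? δ (suc a , suc b)))) ≤ 2 * δ
  few-unseparated δ a t = begin
    ∑ (upTo t) (λ b → 𝟙 (¬? (separated? (suc a , suc b))))
      ≤⟨ ∑-mono (upTo t) near ⟩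
    ∑ (upTo t) (λ b → ∑ (upTo (2 * δ)) (λ i → 𝟙 (b + δ ≟ a + i)))
      ≡⟨ ∑-swap (upTo t) (upTo (2 * δ)) (λ b i → 𝟙 (b + δ ≟ a + i)) ⟩
    ∑ (upTo (2 * δ)) (λ i → ∑ (upTo t) (λ b → 𝟙 (b + δ ≟ a + i)))
      ≤⟨ ∑-mono (upTo (2 * δ)) (λ i → ∑-𝟙≡≤1 (+-cancelʳ-≡ δ _ _) (upTo⁺ t) (a + i)) ⟩
    ∑ (upTo (2 * δ)) (const 1)
      ≡⟨ trans (∑-const (upTo (2 * δ)) 1) (*-identityʳ _) ⟩
    length (upTo (2 * δ))
      ≡⟨ length-upTo (2 * δ) ⟩
    2 * δ ∎
    where
    open Separation δ
    open ≤-Reasoning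
    hit : ∀ (h : ℕ → ℕ) n i → i < n → 𝟙 (h i ≟ h i) ≤ ∑ (upTo n) (λ j → 𝟙 (h i ≟ h j))
    hit h (suc n) zero    _         = m≤m+n _ _
    hit h (suc n) (suc i) (s≤s i<n) = ≤-trans (hit (h ∘ suc) n i i<n)
      (≤-trans (≤-reflexive (sym (∑-applyUpTo suc n _))) (m≤n+m _ _))
    near : ∀ b → 𝟙 (¬? (separated? (suc a , suc b))) ≤ ∑ (upTo (2 * δ)) (λ i → 𝟙 (b + δ ≟ a + i))
    near b with separated? (suc a , suc b)
    ... | yes s = ≤-trans (≤-reflexive (𝟙-no (¬? (yes s)) (λ ¬s → ¬s s))) z≤n
    ... | no ¬s = begin
      𝟙 (¬? (no ¬s))
        ≤⟨ 𝟙≤1 (¬? (no ¬s)) ⟩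
      1
        ≡⟨ 𝟙-yes (a + i ≟ a + i) refl ⟨
      𝟙 (a + i ≟ a + i)
        ≤⟨ hit (a +_) (2 * δ) i i<2δ ⟩
      ∑ (upTo (2 * δ)) (λ j → 𝟙 (a + i ≟ a + j))
        ≡⟨ cong (λ z → ∑ (upTo (2 * δ)) (λ j → 𝟙 (z ≟ a + j))) (m+[n∸m]≡n a≤b+δ) ⟩
      ∑ (upTo (2 * δ)) (λ j → 𝟙 (b + δ ≟ a + j)) ∎
      where
      i = b + δ ∸ a
      a≤b+δ : a ≤ b + δ
      a≤b+δ = ≤-pred (<⇒≤ (≰⇒> (¬s ∘ inj₂)))
      b<a+δ : b < a + δ
      b<a+δ = ≤-pred (≰⇒> (¬s ∘ inj₁))
      i<2δ : i < 2 * δ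
      i<2δ = +-cancelˡ-< a _ _ (begin-strict
        a + i             ≡⟨ m+[n∸m]≡n a≤b+δ ⟩
        b + δ             <⟨ +-monoˡ-< δ b<a+δ ⟩
        a + δ + δ         ≡⟨ lemma a δ ⟩
        a + 2 * δ         ∎)
        where
        lemma : ∀ a δ → a + δ + δ ≡ a + 2 * δ
        lemma = solve-∀

  -- Energy decay

  module Decay (t δ s M : ℕ) where

    open Separation δ

    -- Once s² rows of v are separated, shiftedEnergy v is 4^|v| / (t s) on average, up to a constant.
    HighEnergy : List Row → Row → Set
    HighEnergy v (a , b) = s * s ≤ separatedCount v × M * 4 ^ length v < t * s * shiftedEnergy v a b

    Bad : List Row → Row → Set
    Bad v x = ¬ Separated x ⊎ HighEnergy v x

    highEnergy? : ∀ v → Decidable (HighEnergy v)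
    highEnergy? v (a , b) = (s * s ≤? separatedCount v) ×-dec (M * 4 ^ length v <? t * s * shiftedEnergy v a b)

    bad? : ∀ v → Decidable (Bad v)
    bad? v x = ¬? (separated? x) ⊎-dec highEnergy? v x

    badCount : List Row → ℕ
    badCount []      = 0
    badCount (x ∷ u) = 𝟙 (bad? u x) + badCount u

    length≤separated+bad : ∀ u → length u ≤ separatedCount u + badCount u
    length≤separated+bad u = begin
      length u                                  ≡⟨ separated+unseparated u ⟨
      separatedCount u + unseparatedCount u     ≤⟨ +-monoʳ-≤ (separatedCount u) (unseparated≤bad u) ⟩
      separatedCount u + badCount u             ∎
      where
      open ≤-Reasoning
      unseparated≤bad : ∀ u → unseparatedCount u ≤ badCount u
      unseparated≤bad []      = z≤n
      unseparated≤bad (x ∷ u) = +-mono-≤ (𝟙-mono (¬? (separated? x)) (bad? u x) inj₁) (unseparated≤bad u)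

    energy-decay : ∀ l u → l + s * s + badCount u ≤ length u →
      t * s * energy u * 2 ^ l ≤ 4 ^ length u * (t * s + M * 2 ^ l)
    energy-decay zero u _ = begin
      t * s * energy u * 1                   ≡⟨ *-identityʳ _ ⟩
      t * s * energy u                       ≤⟨ *-monoʳ-≤ (t * s) (energy≤4^ u) ⟩
      t * s * 4 ^ length u                   ≡⟨ *-comm (t * s) _ ⟩
      4 ^ length u * (t * s)                 ≤⟨ *-monoʳ-≤ (4 ^ length u) (m≤m+n _ _) ⟩
      4 ^ length u * (t * s + M * 2 ^ 0)     ∎
      where open ≤-Reasoning
    energy-decay (suc l) [] ()
    energy-decay (suc l) (x@(a , b) ∷ u) l+s²+bad≤ with bad? u x
    ... | yes bad = begin
      t * s * energy (x ∷ u) * 2 ^ suc l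
        ≤⟨ *-monoˡ-≤ (2 ^ suc l) (*-monoʳ-≤ (t * s) (energy-∷≤ x u)) ⟩
      t * s * (4 * energy u) * 2 ^ suc l
        ≡⟨ lemma₁ (t * s) (energy u) (2 ^ suc l) ⟩
      4 * (t * s * energy u * 2 ^ suc l)
        ≤⟨ *-monoʳ-≤ 4 (energy-decay (suc l) u smaller) ⟩
      4 * (4 ^ length u * (t * s + M * 2 ^ suc l))
        ≡⟨ *-assoc 4 (4 ^ length u) _ ⟨
      4 * 4 ^ length u * (t * s + M * 2 ^ suc l) ∎
      where
      open ≤-Reasoning
      lemma₁ : ∀ q e p → q * (4 * e) * p ≡ 4 * (q * e * p)
      lemma₁ = solve-∀
      smaller : suc l + s * s + badCount u ≤ length u
      smaller = ≤-pred (≤-trans (≤-reflexive (trans (sym (+-suc (suc l + s * s) (badCount u)))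
        (cong (λ i → suc l + s * s + (i + badCount u)) (sym (𝟙-yes (yes bad) bad))))) l+s²+bad≤)
    ... | no ¬bad = begin
      t * s * energy (x ∷ u) * 2 ^ suc l
        ≡⟨ cong (λ e → t * s * e * 2 ^ suc l) (energy-∷ a b u) ⟩
      t * s * (2 * (energy u + shiftedEnergy u a b)) * (2 * 2 ^ l)
        ≡⟨ lemma₁ (t * s) (energy u) (shiftedEnergy u a b) (2 ^ l) ⟩
      4 * (t * s * energy u * 2 ^ l) + 4 * (t * s * shiftedEnergy u a b) * 2 ^ l
        ≤⟨ +-mono-≤ (*-monoʳ-≤ 4 (energy-decay l u smaller)) (*-monoˡ-≤ (2 ^ l) (*-monoʳ-≤ 4 low)) ⟩
      4 * (4 ^ length u * (t * s + M * 2 ^ l)) + 4 * (M * 4 ^ length u) * 2 ^ l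
        ≡⟨ lemma₂ (4 ^ length u) (t * s) M (2 ^ l) ⟩
      4 * 4 ^ length u * (t * s + M * (2 * 2 ^ l)) ∎
      where
      open ≤-Reasoning
      lemma₁ : ∀ q e r p → q * (2 * (e + r)) * (2 * p) ≡ 4 * (q * e * p) + 4 * (q * r) * p
      lemma₁ = solve-∀
      lemma₂ : ∀ f q M p → 4 * (f * (q + M * p)) + 4 * (M * f) * p ≡ 4 * f * (q + M * (2 * p))
      lemma₂ = solve-∀
      smaller : l + s * s + badCount u ≤ length u
      smaller = ≤-pred (≤-trans (≤-reflexive (cong (λ i → suc l + s * s + (i + badCount u)) (sym (𝟙-no (no ¬bad) ¬bad)))) l+s²+bad≤)
      s²≤ : s * s ≤ separatedCount u
      s²≤ = +-cancelʳ-≤ (badCount u) _ _ (≤-trans (≤-trans (+-monoˡ-≤ (badCount u) (m≤n+m (s * s) l)) smaller) (length≤separated+bad u))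
      low : t * s * shiftedEnergy u a b ≤ M * 4 ^ length u
      low = ≮⇒≥ (λ high → ¬bad (inj₂ (s²≤ , high)))

  module _ (t δ s K J : ℕ) .{{_ : NonZero J}} (4Kδ≤t : 4 * K * δ ≤ t) (t≤Jδ : t ≤ J * δ) where

    open Separation δ
    open Decay t δ s (2 * K * (3 * J))

    few-high : ∀ u → 2 * K * ∑ (upTo t) (λ a → ∑ (upTo t) (λ b → 𝟙 (highEnergy? u (suc a , suc b)))) ≤ t * t
    few-high u = cases (s * s ≤? separatedCount u)
      where
      open ≤-Reasoning
      M4 = 2 * K * (3 * J) * 4 ^ length u
      high? : ∀ a b → Dec (HighEnergy u (suc a , suc b))
      high? a b = highEnergy? u (suc a , suc b)
      lemma₁ : ∀ K J f x → 3 * J * f * (2 * K * x) ≡ 2 * K * (3 * J) * f * x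
      lemma₁ = solve-∀
      lemma₂ : ∀ t x → t * (t * x) ≡ x * (t * t)
      lemma₂ = solve-∀
      markov : ∀ a b → M4 * 𝟙 (high? a b) ≤ t * s * shiftedEnergy u (suc a) (suc b)
      markov a b = *𝟙≤ M4 (high? a b) (<⇒≤ ∘ proj₂)
      cases : Dec (s * s ≤ separatedCount u) →
        2 * K * ∑ (upTo t) (λ a → ∑ (upTo t) (λ b → 𝟙 (high? a b))) ≤ t * t
      cases (no s²≰) = ≤-trans (≤-reflexive (trans (cong (2 * K *_) (∑-zero (upTo t) λ a → ∑-zero (upTo t) λ b →
        𝟙-no (high? a b) (s²≰ ∘ proj₁))) (*-zeroʳ (2 * K)))) z≤n
      cases (yes s²≤) = *-cancelˡ-≤ (3 * J * 4 ^ length u) {{m*n≢0 (3 * J) (4 ^ length u) {{m*n≢0 3 J}} {{m^n≢0 4 (length u)}}}} (begin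
        3 * J * 4 ^ length u * (2 * K * ∑ (upTo t) (λ a → ∑ (upTo t) (λ b → 𝟙 (high? a b))))
          ≡⟨ lemma₁ K J (4 ^ length u) _ ⟩
        M4 * ∑ (upTo t) (λ a → ∑ (upTo t) (λ b → 𝟙 (high? a b)))
          ≡⟨ trans (∑-cong (upTo t) (λ a → ∑-*ˡ (upTo t) M4 _)) (∑-*ˡ (upTo t) M4 _) ⟨
        ∑ (upTo t) (λ a → ∑ (upTo t) (λ b → M4 * 𝟙 (high? a b)))
          ≤⟨ ∑-mono (upTo t) (λ a → ∑-mono (upTo t) (λ b → markov a b)) ⟩
        ∑ (upTo t) (λ a → ∑ (upTo t) (λ b → t * s * shiftedEnergy u (suc a) (suc b)))
          ≡⟨ trans (∑-cong (upTo t) (λ a → ∑-*ˡ (upTo t) (t * s) _)) (∑-*ˡ (upTo t) (t * s) _) ⟩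
        t * s * ∑ (upTo t) (λ a → ∑ (upTo t) (λ b → shiftedEnergy u (suc a) (suc b)))
          ≡⟨ *-assoc t s _ ⟩
        t * (s * ∑ (upTo t) (λ a → ∑ (upTo t) (λ b → shiftedEnergy u (suc a) (suc b))))
          ≤⟨ *-monoʳ-≤ t (∑-shiftedEnergy J t s u t≤Jδ s²≤) ⟩
        t * (t * (3 * J * 4 ^ length u))
          ≡⟨ lemma₂ t (3 * J * 4 ^ length u) ⟩
        3 * J * 4 ^ length u * (t * t) ∎)

    few-bad : ∀ u → K * ∑ (upTo t) (λ a → ∑ (upTo t) (λ b → 𝟙 (bad? u (suc a , suc b)))) ≤ t * t
    few-bad u = *-cancelˡ-≤ 2 (begin
      2 * (K * ∑ (upTo t) (λ a → ∑ (upTo t) (λ b → 𝟙 (bad? u (suc a , suc b)))))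
        ≤⟨ *-monoʳ-≤ 2 (*-monoʳ-≤ K (∑-mono (upTo t) λ a → ∑-mono (upTo t) λ b → union (suc a , suc b))) ⟩
      2 * (K * ∑ (upTo t) (λ a → ∑ (upTo t) (λ b → 𝟙 (¬? (separated? (suc a , suc b))) + 𝟙 (highEnergy? u (suc a , suc b)))))
        ≡⟨ cong (λ z → 2 * (K * z)) (trans (∑-cong (upTo t) λ a → ∑-+ (upTo t) _ _) (∑-+ (upTo t) _ _)) ⟩
      2 * (K * (unsep + high))
        ≡⟨ lemma₁ K unsep high ⟩
      2 * K * unsep + 2 * K * high
        ≤⟨ +-mono-≤ (*-monoʳ-≤ (2 * K) (∑-mono (upTo t) λ a → few-unseparated δ a t)) (few-high u) ⟩
      2 * K * ∑ (upTo t) (const (2 * δ)) + t * t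
        ≡⟨ cong (λ z → 2 * K * z + t * t) (trans (∑-const (upTo t) (2 * δ)) (cong (_* (2 * δ)) (length-upTo t))) ⟩
      2 * K * (t * (2 * δ)) + t * t
        ≡⟨ lemma₂ K t δ ⟩
      t * (4 * K * δ) + t * t
        ≤⟨ +-monoˡ-≤ (t * t) (*-monoʳ-≤ t 4Kδ≤t) ⟩
      t * t + t * t
        ≡⟨ cong (t * t +_) (+-identityʳ (t * t)) ⟨
      2 * (t * t) ∎)
      where
      open ≤-Reasoning
      unsep = ∑ (upTo t) (λ a → ∑ (upTo t) (λ b → 𝟙 (¬? (separated? (suc a , suc b)))))
      high  = ∑ (upTo t) (λ a → ∑ (upTo t) (λ b → 𝟙 (highEnergy? u (suc a , suc b))))
      lemma₁ : ∀ K x y → 2 * (K * (x + y)) ≡ 2 * K * x + 2 * K * y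
      lemma₁ = solve-∀
      lemma₂ : ∀ K t δ → 2 * K * (t * (2 * δ)) + t * t ≡ t * (4 * K * δ) + t * t
      lemma₂ = solve-∀
      union : ∀ x → 𝟙 (bad? u x) ≤ 𝟙 (¬? (separated? x)) + 𝟙 (highEnergy? u x)
      union x with ¬? (separated? x)
      ... | yes ¬s = ≤-trans (𝟙≤1 (yes ¬s ⊎-dec highEnergy? u x)) (≤-trans (≤-reflexive (sym (𝟙-yes (yes ¬s) ¬s))) (m≤m+n _ _))
      ... | no ¬¬s = ≤-trans (𝟙-mono (no ¬¬s ⊎-dec highEnergy? u x) (highEnergy? u x) λ { (inj₁ ¬s) → ⊥-elim (¬¬s ¬s) ; (inj₂ h) → h }) (m≤n+m _ _)

  row : Vec ℕ 2 → Row
  row (a ∷ b ∷ []) = a , b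

  -- Dealing alternately makes every prepended pair a step of exactly one half,
  -- so that a single count of bad steps controls both halves.
  halves : ∀ {d} → Pairs d → List Row × List Row
  halves []      = [] , []
  halves (x ∷ a) = let u , v = halves a in row x ∷ v , u

  left right : ∀ {d} → Pairs d → List Row
  left  = proj₁ ∘ halves
  right = proj₂ ∘ halves

  length-left+right : ∀ {d} (a : Pairs d) → length (left a) + length (right a) ≡ d
  length-left+right []      = refl
  length-left+right (x ∷ a) = cong suc (trans (+-comm (length (right a)) _) (length-left+right a))

  length-balanced : ∀ {d} (a : Pairs d) → length (right a) ≤ length (left a) × length (left a) ≤ suc (length (right a))
  length-balanced []      = z≤n , z≤n
  length-balanced (x ∷ a) = let r≤l , l≤r = length-balanced a in l≤r , s≤s r≤l

  ∑-choices : ∀ {d} (a : Pairs d) (φ : ℕ → ℕ) →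
    ∑ (choices d) (λ j → φ (Vec.sum (zipWith lookup a j))) ≡
    ∑ (sums (left a)) (λ σ → ∑ (sums (right a)) (λ τ → φ (σ + τ)))
  ∑-choices []      φ = sym (+-identityʳ _)
  ∑-choices {suc d} (x@(a₁ ∷ a₂ ∷ []) ∷ a) φ = begin
    ∑ (choices (suc d)) (λ j → φ (Vec.sum (zipWith lookup (x ∷ a) j)))
      ≡⟨ ∑-cartesianProductWith _∷_ (allFin 2) (choices d) (λ j → φ (Vec.sum (zipWith lookup (x ∷ a) j))) ⟩
    part a₁ + (part a₂ + 0)
      ≡⟨ cong₂ _+_ (half a₁) (trans (+-identityʳ _) (half a₂)) ⟩
    ∑ (sums (right a)) (λ σ → ∑ (sums (left a)) (λ τ → φ (a₁ + σ + τ))) +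
    ∑ (sums (right a)) (λ σ → ∑ (sums (left a)) (λ τ → φ (a₂ + σ + τ)))
      ≡⟨ ∑-sums-∷ a₁ a₂ (right a) _ ⟨
    ∑ (sums ((a₁ , a₂) ∷ right a)) (λ σ → ∑ (sums (left a)) (λ τ → φ (σ + τ))) ∎
    where
    open ≡-Reasoning
    part : ℕ → ℕ
    part c = ∑ (choices d) (λ j → φ (c + Vec.sum (zipWith lookup a j)))
    lemma : ∀ c σ τ → c + (σ + τ) ≡ c + τ + σ
    lemma = solve-∀
    half : ∀ c → part c ≡ ∑ (sums (right a)) (λ σ → ∑ (sums (left a)) (λ τ → φ (c + σ + τ)))
    half c = begin
      part c
        ≡⟨ ∑-choices a (φ ∘ (c +_)) ⟩
      ∑ (sums (left a)) (λ σ → ∑ (sums (right a)) (λ τ → φ (c + (σ + τ))))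
        ≡⟨ ∑-swap (sums (left a)) (sums (right a)) (λ σ τ → φ (c + (σ + τ))) ⟩
      ∑ (sums (right a)) (λ τ → ∑ (sums (left a)) (λ σ → φ (c + (σ + τ))))
        ≡⟨ ∑-cong (sums (right a)) (λ τ → ∑-cong (sums (left a)) λ σ → cong φ (lemma c σ τ)) ⟩
      ∑ (sums (right a)) (λ σ → ∑ (sums (left a)) (λ τ → φ (c + σ + τ))) ∎

  ∑-vectors-2 : ∀ {A : Set} (xs : List A) (f : Vec A 2 → ℕ) →
    ∑ (vectors xs 2) f ≡ ∑ xs (λ x → ∑ xs (λ y → f (x ∷ y ∷ [])))
  ∑-vectors-2 xs f = begin
    ∑ (vectors xs 2) f
      ≡⟨ ∑-cartesianProductWith _∷_ xs (vectors xs 1) f ⟩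
    ∑ xs (λ x → ∑ (vectors xs 1) (λ v → f (x ∷ v)))
      ≡⟨ ∑-cong xs (λ x → ∑-cartesianProductWith _∷_ xs (vectors xs 0) (λ v → f (x ∷ v))) ⟩
    ∑ xs (λ x → ∑ xs (λ y → f (x ∷ y ∷ []) + 0))
      ≡⟨ ∑-cong xs (λ x → ∑-cong xs λ y → +-identityʳ _) ⟩
    ∑ xs (λ x → ∑ xs (λ y → f (x ∷ y ∷ []))) ∎
    where open ≡-Reasoning

  module _ (t δ s M : ℕ) where

    open Decay t δ s M

    totalBad : ∀ {d} → Pairs d → ℕ
    totalBad a = badCount (left a) + badCount (right a)

    totalBad-∷ : ∀ {d} x (a : Pairs d) → totalBad (x ∷ a) ≡ 𝟙 (bad? (right a) (row x)) + totalBad a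
    totalBad-∷ x a = lemma (𝟙 (bad? (right a) (row x))) (badCount (right a)) (badCount (left a))
      where
      lemma : ∀ i r l → i + r + l ≡ i + (l + r)
      lemma = solve-∀

    energy-bound : ∀ e u → 4 * e ≤ length u → s * s ≤ e → badCount u ≤ e → t * s ≤ 2 ^ (2 * e) →
      t * s * energy u ≤ 4 ^ length u * suc M
    energy-bound e u 4e≤ s²≤e bad≤e ts≤ = *-cancelʳ-≤ _ _ (2 ^ (2 * e)) {{m^n≢0 2 (2 * e)}} (begin
      t * s * energy u * 2 ^ (2 * e)
        ≤⟨ energy-decay (2 * e) u (≤-trans (+-mono-≤ (+-monoʳ-≤ (2 * e) s²≤e) bad≤e) (≤-trans (≤-reflexive (lemma₁ e)) 4e≤)) ⟩
      4 ^ length u * (t * s + M * 2 ^ (2 * e))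
        ≤⟨ *-monoʳ-≤ (4 ^ length u) (+-monoˡ-≤ _ ts≤) ⟩
      4 ^ length u * (suc M * 2 ^ (2 * e))
        ≡⟨ *-assoc (4 ^ length u) (suc M) _ ⟨
      4 ^ length u * suc M * 2 ^ (2 * e) ∎)
      where
      open ≤-Reasoning
      lemma₁ : ∀ e → 2 * e + e + e ≡ 4 * e
      lemma₁ = solve-∀

    choices-bound : ∀ {d} e (a : Pairs d) → 8 * e ≤ d → s * s ≤ e → totalBad a ≤ e → t * s ≤ 2 ^ (2 * e) → ∀ n →
      t * s * ∑ (choices d) (λ j → 𝟙 (Vec.sum (zipWith lookup a j) ≟ n)) ≤ 2 * suc M * 2 ^ d
    choices-bound {d} e a 8e≤d s²≤e bad≤e ts≤ n = *-cancelˡ-≤ 2 (begin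
      2 * (t * s * ∑ (choices d) (λ j → 𝟙 (Vec.sum (zipWith lookup a j) ≟ n)))
        ≡⟨ cong (λ z → 2 * (t * s * z)) (∑-choices a (λ i → 𝟙 (i ≟ n))) ⟩
      2 * (t * s * ∑ (sums u) (λ σ → ∑ (sums v) (λ τ → 𝟙 (σ + τ ≟ n))))
        ≡⟨ lemma₁ (t * s) _ ⟩
      t * s * (2 * ∑ (sums u) (λ σ → ∑ (sums v) (λ τ → 𝟙 (σ + τ ≟ n))))
        ≤⟨ *-monoʳ-≤ (t * s) (2*convolution≤energy u v n) ⟩
      t * s * (energy u + energy v)
        ≡⟨ *-distribˡ-+ (t * s) (energy u) (energy v) ⟩
      t * s * energy u + t * s * energy v
        ≤⟨ +-mono-≤ (energy-bound e u (≤-trans 4e≤v r≤l) s²≤e (≤-trans (m≤m+n _ _) bad≤e) ts≤)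
                    (energy-bound e v 4e≤v s²≤e (≤-trans (m≤n+m _ (badCount u)) bad≤e) ts≤) ⟩
      4 ^ length u * suc M + 4 ^ length v * suc M
        ≤⟨ +-mono-≤ (*-monoˡ-≤ (suc M) (4^≤ u 2u≤)) (*-monoˡ-≤ (suc M) (4^≤ v 2v≤)) ⟩
      2 ^ suc d * suc M + 2 ^ suc d * suc M
        ≡⟨ lemma₂ (2 ^ d) (suc M) ⟩
      2 * (2 * suc M * 2 ^ d) ∎)
      where
      open ≤-Reasoning
      u = left a
      v = right a
      r≤l = proj₁ (length-balanced a)
      l≤r = proj₂ (length-balanced a)
      lemma₁ : ∀ q x → 2 * (q * x) ≡ q * (2 * x)
      lemma₁ = solve-∀
      lemma₂ : ∀ p m → 2 * p * m + 2 * p * m ≡ 2 * (2 * m * p)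
      lemma₂ = solve-∀
      lemma₃ : ∀ k → k + suc k ≡ suc (2 * k)
      lemma₃ = solve-∀
      2u≤ : 2 * length u ≤ suc d
      2u≤ = begin
        2 * length u                  ≡⟨ cong (length u +_) (+-identityʳ _) ⟩
        length u + length u           ≤⟨ +-monoʳ-≤ (length u) l≤r ⟩
        length u + suc (length v)     ≡⟨ +-suc (length u) (length v) ⟩
        suc (length u + length v)     ≡⟨ cong suc (length-left+right a) ⟩
        suc d                         ∎
      2v≤ : 2 * length v ≤ suc d
      2v≤ = ≤-trans (*-monoʳ-≤ 2 r≤l) 2u≤
      4^≤ : ∀ w → 2 * length w ≤ suc d → 4 ^ length w ≤ 2 ^ suc d
      4^≤ w 2w≤ = ≤-trans (≤-reflexive (^-*-assoc 2 2 (length w))) (^-monoʳ-≤ 2 2w≤)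
      4e≤v : 4 * e ≤ length v
      4e≤v = ≮⇒≥ λ v<4e → <⇒≱ (begin-strict
        d                             ≡⟨ length-left+right a ⟨
        length u + length v           ≡⟨ +-comm (length u) _ ⟩
        length v + length u           ≤⟨ +-monoʳ-≤ (length v) l≤r ⟩
        length v + suc (length v)     <⟨ +-mono-<-≤ v<4e v<4e ⟩
        4 * e + 4 * e                 ≡⟨ lemma₄ e ⟩
        8 * e                         ∎) 8e≤d
        where
        lemma₄ : ∀ e → 4 * e + 4 * e ≡ 8 * e
        lemma₄ = solve-∀

  -- Sampling

  entries : ℕ → List ℕ
  entries t = map suc (upTo t)

  length-entries : ∀ t → length (entries t) ≡ t
  length-entries t = trans (length-map suc (upTo t)) (length-upTo t)

  hits : ∀ {n} → ℕ → Vec ℕ n → ℕ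
  hits x ys = ∑ (toList ys) (λ y → 𝟙 (x ≟ y))

  ∑-hits : ∀ t {n} (ys : Vec ℕ n) → ∑ (entries t) (λ x → hits x ys) ≤ n
  ∑-hits t {n} ys = begin
    ∑ (entries t) (λ x → hits x ys)
      ≡⟨ ∑-swap (entries t) (toList ys) (λ x y → 𝟙 (x ≟ y)) ⟩
    ∑ (toList ys) (λ y → ∑ (entries t) (λ x → 𝟙 (x ≟ y)))
      ≤⟨ ∑-mono (toList ys) (λ y → ∑-𝟙≡≤1 id (map⁺ suc-injective (upTo⁺ t)) y) ⟩
    ∑ (toList ys) (const 1)
      ≡⟨ trans (∑-const (toList ys) 1) (*-identityʳ _) ⟩
    length (toList ys)
      ≡⟨ length-toList ys ⟩
    n ∎
    where open ≤-Reasoning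

  𝟙-unique-∷ : ∀ {n} x (ys : Vec ℕ n) → 𝟙 (unique? ys) ≤ 𝟙 (unique? (x ∷ ys)) + hits x ys
  𝟙-unique-∷ x ys = 𝟙≤ (unique? ys) (λ u → fresh x ys u (unique? (x ∷ ys)))
    where
    hit : ∀ {n} x (ys : Vec ℕ n) → 1 ≤ hits x ys ⊎ VecAll.All (x ≢_) ys
    hit x []       = inj₂ VecAll.[]
    hit x (y ∷ ys) with x ≟ y
    ... | yes x≡y = inj₁ (≤-trans (≤-reflexive (sym (𝟙-yes (yes x≡y) x≡y))) (m≤m+n _ _))
    ... | no x≢y with hit x ys
    ... | inj₁ 1≤ = inj₁ (≤-trans 1≤ (m≤n+m _ _))
    ... | inj₂ x∉ = inj₂ (x≢y VecAll.∷ x∉)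
    fresh : ∀ {n} x (ys : Vec ℕ n) → Unique ys → (p : Dec (Unique (x ∷ ys))) → 1 ≤ 𝟙 p + hits x ys
    fresh x ys u p with hit x ys
    ... | inj₁ 1≤ = ≤-trans 1≤ (m≤n+m _ _)
    ... | inj₂ x∉ = ≤-trans (≤-reflexive (sym (𝟙-yes p (x∉ ∷ u)))) (m≤m+n _ _)

  extend-unique : ∀ t {n} (ys : Vec ℕ n) →
    t * 𝟙 (unique? ys) ≤ ∑ (entries t) (λ x → 𝟙 (unique? (x ∷ ys))) + n
  extend-unique t {n} ys = begin
    t * 𝟙 (unique? ys)
      ≡⟨ cong (_* 𝟙 (unique? ys)) (length-entries t) ⟨
    length (entries t) * 𝟙 (unique? ys)
      ≡⟨ ∑-const (entries t) _ ⟨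
    ∑ (entries t) (const (𝟙 (unique? ys)))
      ≤⟨ ∑-mono (entries t) (λ x → 𝟙-unique-∷ x ys) ⟩
    ∑ (entries t) (λ x → 𝟙 (unique? (x ∷ ys)) + hits x ys)
      ≡⟨ ∑-+ (entries t) _ _ ⟩
    ∑ (entries t) (λ x → 𝟙 (unique? (x ∷ ys))) + ∑ (entries t) (λ x → hits x ys)
      ≤⟨ +-monoʳ-≤ _ (∑-hits t ys) ⟩
    ∑ (entries t) (λ x → 𝟙 (unique? (x ∷ ys))) + n ∎
    where open ≤-Reasoning

  extend-unique² : ∀ t {n} (ys : Vec ℕ n) → 2 * (2 * n + 1) ≤ t →
    t * t * 𝟙 (unique? ys) ≤ 2 * ∑ (vectors (entries t) 2) (λ x → 𝟙 (unique? (x Vec.++ ys)))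
  extend-unique² t {n} ys small = *𝟙≤ (t * t) (unique? ys) λ u →
    +-cancelʳ-≤ (t * t) _ _ (begin
      t * t + t * t
        ≡⟨ cong (t * t +_) (+-identityʳ _) ⟨
      2 * (t * t)
        ≤⟨ *-monoʳ-≤ 2 (count u) ⟩
      2 * (X + t * (2 * n + 1))
        ≡⟨ lemma₁ X t (2 * n + 1) ⟩
      2 * X + t * (2 * (2 * n + 1))
        ≤⟨ +-monoʳ-≤ (2 * X) (*-monoʳ-≤ t small) ⟩
      2 * X + t * t ∎)
    where
    open ≤-Reasoning
    X = ∑ (vectors (entries t) 2) (λ x → 𝟙 (unique? (x Vec.++ ys)))
    lemma₁ : ∀ X t m → 2 * (X + t * m) ≡ 2 * X + t * (2 * m)
    lemma₁ = solve-∀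
    lemma₂ : ∀ X t n → X + t * suc n + t * n ≡ X + t * (2 * n + 1)
    lemma₂ = solve-∀
    count : Unique ys → t * t ≤ X + t * (2 * n + 1)
    count u = begin
      t * t
        ≡⟨ cong (t *_) (trans (cong (t *_) (𝟙-yes (unique? ys) u)) (*-identityʳ t)) ⟨
      t * (t * 𝟙 (unique? ys))
        ≤⟨ *-monoʳ-≤ t (extend-unique t ys) ⟩
      t * (∑ (entries t) (λ y → 𝟙 (unique? (y ∷ ys))) + n)
        ≡⟨ trans (*-distribˡ-+ t _ n) (cong (_+ t * n) (sym (∑-*ˡ (entries t) t _))) ⟩
      ∑ (entries t) (λ y → t * 𝟙 (unique? (y ∷ ys))) + t * n
        ≤⟨ +-monoˡ-≤ (t * n) (∑-mono (entries t) λ y → extend-unique t (y ∷ ys)) ⟩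
      ∑ (entries t) (λ y → ∑ (entries t) (λ x → 𝟙 (unique? (x ∷ y ∷ ys))) + suc n) + t * n
        ≡⟨ cong (_+ t * n) (∑-+ (entries t) _ _) ⟩
      ∑ (entries t) (λ y → ∑ (entries t) (λ x → 𝟙 (unique? (x ∷ y ∷ ys)))) + ∑ (entries t) (const (suc n)) + t * n
        ≡⟨ cong₂ (λ i j → i + j + t * n)
             (trans (∑-swap (entries t) (entries t) (λ y x → 𝟙 (unique? (x ∷ y ∷ ys)))) (sym (∑-vectors-2 (entries t) _)))
             (trans (∑-const (entries t) (suc n)) (cong (_* suc n) (length-entries t))) ⟩
      X + t * suc n + t * n
        ≡⟨ lemma₂ X t n ⟩
      X + t * (2 * n + 1) ∎

  many-disjointPairs : ∀ t d → 8 * d ≤ t → (t * t) ^ d ≤ 2 ^ d * length (disjointPairs t d)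
  many-disjointPairs t d 8d≤t = ≤-trans (go d 8d≤t) (≤-reflexive (cong (2 ^ d *_) (sym (length-filter-∑ (λ a → unique? (concat a)) (vectors (vectors (entries t) 2) d)))))
    where
    open ≤-Reasoning
    pairs = vectors (entries t) 2
    go : ∀ d → 8 * d ≤ t → (t * t) ^ d ≤ 2 ^ d * ∑ (vectors pairs d) (λ a → 𝟙 (unique? (concat a)))
    go zero    _      = ≤-reflexive (sym (trans (+-identityʳ _) (trans (+-identityʳ _) (𝟙-yes (unique? []) []))))
    go (suc d) 8d≤t = begin
      t * t * (t * t) ^ d
        ≤⟨ *-monoʳ-≤ (t * t) (go d (≤-trans (*-monoʳ-≤ 8 (n≤1+n d)) 8d≤t)) ⟩
      t * t * (2 ^ d * ∑ (vectors pairs d) (λ a → 𝟙 (unique? (concat a))))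
        ≡⟨ lemma₁ (t * t) (2 ^ d) _ ⟩
      2 ^ d * (t * t * ∑ (vectors pairs d) (λ a → 𝟙 (unique? (concat a))))
        ≡⟨ cong (2 ^ d *_) (∑-*ˡ (vectors pairs d) (t * t) _) ⟨
      2 ^ d * ∑ (vectors pairs d) (λ a → t * t * 𝟙 (unique? (concat a)))
        ≤⟨ *-monoʳ-≤ (2 ^ d) (∑-mono (vectors pairs d) λ a → extend-unique² t (concat a) small) ⟩
      2 ^ d * ∑ (vectors pairs d) (λ a → 2 * ∑ pairs (λ x → 𝟙 (unique? (concat (x ∷ a)))))
        ≡⟨ cong (2 ^ d *_) (∑-*ˡ (vectors pairs d) 2 _) ⟩
      2 ^ d * (2 * ∑ (vectors pairs d) (λ a → ∑ pairs (λ x → 𝟙 (unique? (concat (x ∷ a))))))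
        ≡⟨ lemma₂ (2 ^ d) _ ⟩
      2 * 2 ^ d * ∑ (vectors pairs d) (λ a → ∑ pairs (λ x → 𝟙 (unique? (concat (x ∷ a)))))
        ≡⟨ cong (2 * 2 ^ d *_) (∑-swap (vectors pairs d) pairs (λ a x → 𝟙 (unique? (concat (x ∷ a))))) ⟩
      2 * 2 ^ d * ∑ pairs (λ x → ∑ (vectors pairs d) (λ a → 𝟙 (unique? (concat (x ∷ a)))))
        ≡⟨ cong (2 * 2 ^ d *_) (∑-cartesianProductWith _∷_ pairs (vectors pairs d) (λ a → 𝟙 (unique? (concat a)))) ⟨
      2 * 2 ^ d * ∑ (vectors pairs (suc d)) (λ a → 𝟙 (unique? (concat a))) ∎
      where
      lemma₁ : ∀ q p x → q * (p * x) ≡ p * (q * x)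
      lemma₁ = solve-∀
      lemma₂ : ∀ p x → p * (2 * x) ≡ 2 * p * x
      lemma₂ = solve-∀
      lemma₃ : ∀ d → 2 * (2 * (d * 2) + 1) + 6 ≡ 8 * suc d
      lemma₃ = solve-∀
      small : 2 * (2 * (d * 2) + 1) ≤ t
      small = ≤-trans (≤-trans (m≤m+n _ 6) (≤-reflexive (lemma₃ d))) 8d≤t

  module _ (t δ s K J : ℕ) .{{_ : NonZero K}} .{{_ : NonZero J}} (4Kδ≤t : 4 * K * δ ≤ t) (t≤Jδ : t ≤ J * δ) where

    private
      M = 2 * K * (3 * J)
      pairs = vectors (entries t) 2
      bads : ∀ {d} → Pairs d → ℕ
      bads = totalBad t δ s M

    open Decay t δ s M

    ∑-K^bad : ∀ u → ∑ pairs (λ x → K ^ 𝟙 (bad? u (row x))) ≤ 2 * (t * t)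
    ∑-K^bad u = begin
      ∑ pairs (λ x → K ^ 𝟙 (bad? u (row x)))
        ≤⟨ ∑-mono pairs (λ x → K^𝟙≤ (bad? u (row x))) ⟩
      ∑ pairs (λ x → 1 + K * 𝟙 (bad? u (row x)))
        ≡⟨ trans (∑-vectors-2 (entries t) _) (trans (∑-map suc (upTo t) _) (∑-cong (upTo t) λ a → ∑-map suc (upTo t) _)) ⟩
      ∑ (upTo t) (λ a → ∑ (upTo t) (λ b → 1 + K * 𝟙 (bad? u (suc a , suc b))))
        ≡⟨ trans (∑-cong (upTo t) λ a → ∑-+ (upTo t) _ _) (∑-+ (upTo t) _ _) ⟩
      ∑ (upTo t) (λ a → ∑ (upTo t) (const 1)) + ∑ (upTo t) (λ a → ∑ (upTo t) (λ b → K * 𝟙 (bad? u (suc a , suc b))))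
        ≡⟨ cong₂ _+_
             (trans (∑-const (upTo t) _) (cong₂ _*_ (length-upTo t) (trans (∑-const (upTo t) 1) (trans (*-identityʳ _) (length-upTo t)))))
             (trans (∑-cong (upTo t) λ a → ∑-*ˡ (upTo t) K _) (∑-*ˡ (upTo t) K _)) ⟩
      t * t + K * ∑ (upTo t) (λ a → ∑ (upTo t) (λ b → 𝟙 (bad? u (suc a , suc b))))
        ≤⟨ +-monoʳ-≤ (t * t) (few-bad t δ s K J 4Kδ≤t t≤Jδ u) ⟩
      t * t + t * t
        ≡⟨ cong (t * t +_) (+-identityʳ _) ⟨
      2 * (t * t) ∎
      where
      open ≤-Reasoning
      K^𝟙≤ : ∀ {P : Set} (p : Dec P) → K ^ 𝟙 p ≤ 1 + K * 𝟙 p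
      K^𝟙≤ (yes p) = ≤-trans (≤-reflexive (cong (K ^_) (𝟙-yes (yes p) p)))
        (≤-trans (n≤1+n (K * 1)) (≤-reflexive (cong (λ i → suc (K * i)) (sym (𝟙-yes (yes p) p)))))
      K^𝟙≤ (no ¬p) = ≤-trans (≤-reflexive (cong (K ^_) (𝟙-no (no ¬p) ¬p))) (m≤m+n 1 _)

    ∑-K^totalBad : ∀ d → ∑ (vectors pairs d) (λ a → K ^ bads a) ≤ (2 * (t * t)) ^ d
    ∑-K^totalBad zero    = ≤-refl
    ∑-K^totalBad (suc d) = begin
      ∑ (vectors pairs (suc d)) (λ a → K ^ bads a)
        ≡⟨ ∑-cartesianProductWith _∷_ pairs (vectors pairs d) _ ⟩
      ∑ pairs (λ x → ∑ (vectors pairs d) (λ a → K ^ bads (x ∷ a)))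
        ≡⟨ ∑-swap pairs (vectors pairs d) (λ x a → K ^ bads (x ∷ a)) ⟩
      ∑ (vectors pairs d) (λ a → ∑ pairs (λ x → K ^ bads (x ∷ a)))
        ≡⟨ ∑-cong (vectors pairs d) (λ a → ∑-cong pairs λ x →
             trans (cong (K ^_) (totalBad-∷ t δ s M x a)) (^-distribˡ-+-* K (𝟙 (bad? (right a) (row x))) (bads a))) ⟩
      ∑ (vectors pairs d) (λ a → ∑ pairs (λ x → K ^ 𝟙 (bad? (right a) (row x)) * K ^ bads a))
        ≡⟨ ∑-cong (vectors pairs d) (λ a → ∑-*ʳ pairs (K ^ bads a) _) ⟩
      ∑ (vectors pairs d) (λ a → ∑ pairs (λ x → K ^ 𝟙 (bad? (right a) (row x))) * K ^ bads a)
        ≤⟨ ∑-mono (vectors pairs d) (λ a → *-monoˡ-≤ (K ^ bads a) (∑-K^bad (right a))) ⟩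
      ∑ (vectors pairs d) (λ a → 2 * (t * t) * K ^ bads a)
        ≡⟨ ∑-*ˡ (vectors pairs d) (2 * (t * t)) _ ⟩
      2 * (t * t) * ∑ (vectors pairs d) (λ a → K ^ bads a)
        ≤⟨ *-monoʳ-≤ (2 * (t * t)) (∑-K^totalBad d) ⟩
      2 * (t * t) * (2 * (t * t)) ^ d ∎
      where open ≤-Reasoning

    few-totalBad : ∀ d e → K ^ suc e * ∑ (vectors pairs d) (λ a → 𝟙 (e <? bads a)) ≤ (2 * (t * t)) ^ d
    few-totalBad d e = begin
      K ^ suc e * ∑ (vectors pairs d) (λ a → 𝟙 (e <? bads a))
        ≡⟨ ∑-*ˡ (vectors pairs d) (K ^ suc e) _ ⟨
      ∑ (vectors pairs d) (λ a → K ^ suc e * 𝟙 (e <? bads a))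
        ≤⟨ ∑-mono (vectors pairs d) pointwise ⟩
      ∑ (vectors pairs d) (λ a → K ^ bads a)
        ≤⟨ ∑-K^totalBad d ⟩
      (2 * (t * t)) ^ d ∎
      where
      open ≤-Reasoning
      pointwise : ∀ a → K ^ suc e * 𝟙 (e <? bads a) ≤ K ^ bads a
      pointwise a = *𝟙≤ (K ^ suc e) (e <? bads a) (^-monoʳ-≤ K)

    few-exceptional : ∀ {d} e {S : Pred (Pairs d) _} (S? : Decidable S) → (∀ a → bads a ≤ e → S a) →
      8 * d ≤ t → 4 ^ d * (t * t) ≤ K ^ suc e →
      let Ω = disjointPairs t d in
      t * t * length Ω ≤ t * t * length (filter S? Ω) + length Ω
    few-exceptional {d} e S? few⇒S 8d≤t 4^d≤ = begin
      t * t * length Ω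
        ≤⟨ *-monoʳ-≤ (t * t) split ⟩
      t * t * (length (filter S? Ω) + X)
        ≡⟨ *-distribˡ-+ (t * t) (length (filter S? Ω)) X ⟩
      t * t * length (filter S? Ω) + t * t * X
        ≤⟨ +-monoʳ-≤ (t * t * length (filter S? Ω)) rare ⟩
      t * t * length (filter S? Ω) + length Ω ∎
      where
      open ≤-Reasoning
      Ω = disjointPairs t d
      X = ∑ (vectors pairs d) (λ a → 𝟙 (e <? bads a))
      lemma₁ : ∀ p q X → p * (q * X) ≡ p * q * X
      lemma₁ = solve-∀
      rare : t * t * X ≤ length Ω
      rare = *-cancelˡ-≤ (4 ^ d) {{m^n≢0 4 d}} (begin
        4 ^ d * (t * t * X)           ≡⟨ lemma₁ (4 ^ d) (t * t) X ⟩
        4 ^ d * (t * t) * X           ≤⟨ *-monoˡ-≤ X 4^d≤ ⟩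
        K ^ suc e * X                 ≤⟨ few-totalBad d e ⟩
        (2 * (t * t)) ^ d             ≡⟨ ^-distribʳ-* d 2 (t * t) ⟩
        2 ^ d * (t * t) ^ d           ≤⟨ *-monoʳ-≤ (2 ^ d) (many-disjointPairs t d 8d≤t) ⟩
        2 ^ d * (2 ^ d * length Ω)    ≡⟨ lemma₁ (2 ^ d) (2 ^ d) _ ⟩
        2 ^ d * 2 ^ d * length Ω      ≡⟨ cong (_* length Ω) (^-distribʳ-* d 2 2) ⟨
        4 ^ d * length Ω              ∎)
      pointwise : ∀ a → 𝟙 (unique? (concat a)) ≤ 𝟙 (unique? (concat a)) * 𝟙 (S? a) + 𝟙 (e <? bads a)
      pointwise a with e <? bads a
      ... | yes e< = ≤-trans (𝟙≤1 (unique? (concat a))) (≤-trans (≤-reflexive (sym (𝟙-yes (yes e<) e<))) (m≤n+m _ (𝟙 (unique? (concat a)) * 𝟙 (S? a))))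
      ... | no ¬e< = ≤-trans (≤-reflexive (sym (trans (cong (𝟙 (unique? (concat a)) *_) (𝟙-yes (S? a) (few⇒S a (≮⇒≥ ¬e<)))) (*-identityʳ _)))) (m≤m+n _ _)
      split : length Ω ≤ length (filter S? Ω) + X
      split = begin
        length Ω
          ≡⟨ length-filter-∑ (λ a → unique? (concat a)) (vectors pairs d) ⟩
        ∑ (vectors pairs d) (λ a → 𝟙 (unique? (concat a)))
          ≤⟨ ∑-mono (vectors pairs d) pointwise ⟩
        ∑ (vectors pairs d) (λ a → 𝟙 (unique? (concat a)) * 𝟙 (S? a) + 𝟙 (e <? bads a))
          ≡⟨ ∑-+ (vectors pairs d) _ _ ⟩
        ∑ (vectors pairs d) (λ a → 𝟙 (unique? (concat a)) * 𝟙 (S? a)) + X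
          ≡⟨ cong (_+ X) (trans (length-filter-∑ S? Ω) (∑-filter (λ a → unique? (concat a)) (vectors pairs d) (𝟙 ∘ S?))) ⟨
        length (filter S? Ω) + X ∎

  infixl 8 _/1+_

  _/1+_ : ℕ → ℕ → ℚ
  a /1+ n = ℤ.+ a ℚ./ suc n

  toℚᵘ-/1+ : ∀ a n → toℚᵘ (a /1+ n) ℚᵘ.≃ mkℚᵘ (ℤ.+ a) n
  toℚᵘ-/1+ a n = ℚ.toℚᵘ-fromℚᵘ (mkℚᵘ (ℤ.+ a) n)

  /1+-≡ : ∀ a m b n → a * suc n ≡ b * suc m → a /1+ m ≡ b /1+ n
  /1+-≡ a m b n eq = ℚ.fromℚᵘ-cong {mkℚᵘ (ℤ.+ a) m} {mkℚᵘ (ℤ.+ b) n} (ℚᵘ.*≡* (begin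
    ℤ.+ a ℤ.* ℤ.+ suc n     ≡⟨ ℤ.pos-* a (suc n) ⟨
    ℤ.+ (a * suc n)         ≡⟨ cong ℤ.+_ eq ⟩
    ℤ.+ (b * suc m)         ≡⟨ ℤ.pos-* b (suc m) ⟩
    ℤ.+ b ℤ.* ℤ.+ suc m     ∎))
    where open ≡-Reasoning

  /1+-mono-≤ : ∀ a m b n → a * suc n ≤ b * suc m → a /1+ m ℚ.≤ b /1+ n
  /1+-mono-≤ a m b n le = ℚ.toℚᵘ-cancel-≤
    (ℚᵘ.≤-respˡ-≃ (ℚᵘ.≃-sym (toℚᵘ-/1+ a m)) (ℚᵘ.≤-respʳ-≃ (ℚᵘ.≃-sym (toℚᵘ-/1+ b n))
      (ℚᵘ.*≤* (subst₂ ℤ._≤_ (ℤ.pos-* a (suc n)) (ℤ.pos-* b (suc m)) (ℤ.+≤+ le)))))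

  /1+-cancel-≤ : ∀ a m b n → a /1+ m ℚ.≤ b /1+ n → a * suc n ≤ b * suc m
  /1+-cancel-≤ a m b n le with ℚᵘ.≤-respˡ-≃ (toℚᵘ-/1+ a m) (ℚᵘ.≤-respʳ-≃ (toℚᵘ-/1+ b n) (ℚ.toℚᵘ-mono-≤ le))
  ... | ℚᵘ.*≤* le′ = ℤ.drop‿+≤+ (subst₂ ℤ._≤_ (sym (ℤ.pos-* a (suc n))) (sym (ℤ.pos-* b (suc m))) le′)

  /1+-* : ∀ a m b n → a /1+ m ℚ.* b /1+ n ≡ (a * b) /1+ (n + m * suc n)
  /1+-* a m b n = ℚ.toℚᵘ-injective (ℚᵘ.≃-trans (ℚ.toℚᵘ-homo-* (a /1+ m) (b /1+ n))
    (ℚᵘ.≃-trans (ℚᵘ.*-cong (toℚᵘ-/1+ a m) (toℚᵘ-/1+ b n))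
      (ℚᵘ.≃-trans (ℚᵘ.*≡* (cong (ℤ._* ℤ.+ suc (n + m * suc n)) (sym (ℤ.pos-* a b)))) (ℚᵘ.≃-sym (toℚᵘ-/1+ (a * b) (n + m * suc n))))))

  /1+-+ : ∀ a m b n → a /1+ m ℚ.+ b /1+ n ≡ (a * suc n + b * suc m) /1+ (n + m * suc n)
  /1+-+ a m b n = ℚ.toℚᵘ-injective (ℚᵘ.≃-trans (ℚ.toℚᵘ-homo-+ (a /1+ m) (b /1+ n))
    (ℚᵘ.≃-trans (ℚᵘ.+-cong (toℚᵘ-/1+ a m) (toℚᵘ-/1+ b n))
      (ℚᵘ.≃-trans (ℚᵘ.*≡* (cong (ℤ._* ℤ.+ suc (n + m * suc n)) (trans
        (cong₂ ℤ._+_ (sym (ℤ.pos-* a (suc n))) (sym (ℤ.pos-* b (suc m))))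
        (sym (ℤ.pos-+ (a * suc n) (b * suc m))))))
        (ℚᵘ.≃-sym (toℚᵘ-/1+ (a * suc n + b * suc m) (n + m * suc n))))))

  /1+-nonNeg : ∀ a n → NonNegative (a /1+ n)
  /1+-nonNeg a n = ℚ.normalize-nonNeg a (suc n)

  ℕ→ℚ-suc : ∀ n → ℕ→ℚ (suc n) ≡ ℕ→ℚ n ℚ.+ 1ℚ
  ℕ→ℚ-suc n = trans (cong (_/1+ 0) (lemma n)) (sym (/1+-+ n 0 1 0))
    where
    lemma : ∀ n → 1 + n ≡ n * 1 + 1
    lemma = solve-∀

  ℕ→ℚ-* : ∀ m n → ℕ→ℚ (m * n) ≡ ℕ→ℚ m ℚ.* ℕ→ℚ n
  ℕ→ℚ-* m n = sym (/1+-* m 0 n 0)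

  ℕ→ℚ-*-/1+ : ∀ n → ℕ→ℚ (suc n) ℚ.* 1 /1+ n ≡ 1ℚ
  ℕ→ℚ-*-/1+ n = trans (/1+-* (suc n) 0 1 n) (/1+-≡ (suc n * 1) (n + 0) 1 0 (lemma n))
    where
    lemma : ∀ n → (1 + n) * 1 * 1 ≡ 1 * (1 + (n + 0))
    lemma = solve-∀

  -- The exponential series

  expTerm-nonNeg : ∀ x .{{_ : NonNegative x}} k → NonNegative (expTerm x k)
  expTerm-nonNeg x zero    = _
  expTerm-nonNeg x (suc k) = ℚ.nonNeg*nonNeg⇒nonNeg (expTerm x k) {{expTerm-nonNeg x k}} (x ℚ.* 1 /1+ k)
    {{ℚ.nonNeg*nonNeg⇒nonNeg x (1 /1+ k) {{/1+-nonNeg 1 k}}}}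

  -- That is, (x + h)ᵐ ≤ xᵐ + m h (x + h)ᵐ⁻¹ with m = k + 1.
  expTerm-+ : ∀ x h .{{_ : NonNegative x}} .{{_ : NonNegative h}} k →
    expTerm (x ℚ.+ h) (suc k) ℚ.≤ expTerm x (suc k) ℚ.+ h ℚ.* expTerm (x ℚ.+ h) k
  expTerm-+ x h zero = ℚ.≤-reflexive (solve 2 (λ x h →
      con 1ℚ :* ((x :+ h) :* con 1ℚ) := con 1ℚ :* (x :* con 1ℚ) :+ h :* con 1ℚ) refl x h)
    where open +-*-Solver
  expTerm-+ x h (suc k) = begin
    b ℚ.* ((x ℚ.+ h) ℚ.* w)
      ≡⟨ solve 4 (λ x h b w → b :* ((x :+ h) :* w) := b :* (x :* w) :+ h :* (b :* w)) refl x h b w ⟩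
    b ℚ.* (x ℚ.* w) ℚ.+ h ℚ.* (b ℚ.* w)
      ≤⟨ ℚ.+-monoˡ-≤ _ (ℚ.*-monoʳ-≤-nonNeg (x ℚ.* w) {{ℚ.nonNeg*nonNeg⇒nonNeg x w {{nonNeg-w}}}} (expTerm-+ x h k)) ⟩
    (e ℚ.+ h ℚ.* a) ℚ.* (x ℚ.* w) ℚ.+ h ℚ.* (b ℚ.* w)
      ≡⟨ solve 6 (λ x h a b e w → (e :+ h :* a) :* (x :* w) :+ h :* (b :* w) := e :* (x :* w) :+ h :* (a :* (w :* x) :+ b :* w)) refl x h a b e w ⟩
    e ℚ.* (x ℚ.* w) ℚ.+ h ℚ.* (a ℚ.* (w ℚ.* x) ℚ.+ b ℚ.* w)
      ≤⟨ ℚ.+-monoʳ-≤ (e ℚ.* (x ℚ.* w)) (ℚ.*-monoˡ-≤-nonNeg h (ℚ.+-monoˡ-≤ (b ℚ.* w) enlarge)) ⟩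
    e ℚ.* (x ℚ.* w) ℚ.+ h ℚ.* (a ℚ.* (w ℚ.* (x ℚ.+ h)) ℚ.+ b ℚ.* w)
      ≡⟨ cong (λ z → e ℚ.* (x ℚ.* w) ℚ.+ h ℚ.* z) collect ⟩
    e ℚ.* (x ℚ.* w) ℚ.+ h ℚ.* b ∎
    where
    open ℚ.≤-Reasoning
    open +-*-Solver
    a = expTerm (x ℚ.+ h) k
    b = expTerm (x ℚ.+ h) (suc k)
    e = expTerm x (suc k)
    v = 1 /1+ k
    w = 1 /1+ suc k
    n = ℕ→ℚ (suc k)
    nonNeg-w : NonNegative w
    nonNeg-w = /1+-nonNeg 1 (suc k)
    enlarge : a ℚ.* (w ℚ.* x) ℚ.≤ a ℚ.* (w ℚ.* (x ℚ.+ h))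
    enlarge = ℚ.*-monoˡ-≤-nonNeg a {{expTerm-nonNeg (x ℚ.+ h) {{ℚ.nonNeg+nonNeg⇒nonNeg x h}} k}} (ℚ.*-monoˡ-≤-nonNeg w {{nonNeg-w}}
      (ℚ.≤-trans (ℚ.≤-reflexive (sym (ℚ.+-identityʳ x))) (ℚ.+-monoʳ-≤ x (ℚ.nonNegative⁻¹ h))))
    collect : a ℚ.* (w ℚ.* (x ℚ.+ h)) ℚ.+ b ℚ.* w ≡ b
    collect = begin-equality
      a ℚ.* (w ℚ.* (x ℚ.+ h)) ℚ.+ b ℚ.* w
        ≡⟨ cong (ℚ._+ b ℚ.* w) (ℚ.*-identityˡ (a ℚ.* (w ℚ.* (x ℚ.+ h)))) ⟨
      1ℚ ℚ.* (a ℚ.* (w ℚ.* (x ℚ.+ h))) ℚ.+ b ℚ.* w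
        ≡⟨ cong (λ z → z ℚ.* (a ℚ.* (w ℚ.* (x ℚ.+ h))) ℚ.+ b ℚ.* w) (ℕ→ℚ-*-/1+ k) ⟨
      n ℚ.* v ℚ.* (a ℚ.* (w ℚ.* (x ℚ.+ h))) ℚ.+ b ℚ.* w
        ≡⟨ solve 5 (λ n v a w y → n :* v :* (a :* (w :* y)) :+ a :* (y :* v) :* w := a :* (y :* v) :* ((n :+ con 1ℚ) :* w)) refl n v a w (x ℚ.+ h) ⟩
      b ℚ.* ((n ℚ.+ 1ℚ) ℚ.* w)
        ≡⟨ cong (λ z → b ℚ.* (z ℚ.* w)) (ℕ→ℚ-suc (suc k)) ⟨
      b ℚ.* (ℕ→ℚ (suc (suc k)) ℚ.* w)
        ≡⟨ cong (b ℚ.*_) (ℕ→ℚ-*-/1+ (suc k)) ⟩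
      b ℚ.* 1ℚ
        ≡⟨ ℚ.*-identityʳ b ⟩
      b ∎

  expSum-+ : ∀ x h .{{_ : NonNegative x}} .{{_ : NonNegative h}} k →
    expSum (x ℚ.+ h) (suc k) ℚ.≤ expSum x (suc k) ℚ.+ h ℚ.* expSum (x ℚ.+ h) k
  expSum-+ x h zero = ℚ.≤-trans (ℚ.+-monoʳ-≤ 1ℚ (expTerm-+ x h 0)) (ℚ.≤-reflexive (sym (ℚ.+-assoc 1ℚ (expTerm x 1) (h ℚ.* 1ℚ))))
  expSum-+ x h (suc k) = begin
    expSum (x ℚ.+ h) (suc k) ℚ.+ expTerm (x ℚ.+ h) (suc (suc k))
      ≤⟨ ℚ.+-mono-≤ (expSum-+ x h k) (expTerm-+ x h (suc k)) ⟩
    (S ℚ.+ h ℚ.* S′) ℚ.+ (T ℚ.+ h ℚ.* T′)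
      ≡⟨ solve 5 (λ h S S′ T T′ → (S :+ h :* S′) :+ (T :+ h :* T′) := S :+ T :+ h :* (S′ :+ T′)) refl h S S′ T T′ ⟩
    S ℚ.+ T ℚ.+ h ℚ.* (S′ ℚ.+ T′) ∎
    where
    open ℚ.≤-Reasoning
    open +-*-Solver
    S  = expSum x (suc k)
    S′ = expSum (x ℚ.+ h) k
    T  = expTerm x (suc (suc k))
    T′ = expTerm (x ℚ.+ h) (suc k)

  expSum-+′ : ∀ x h .{{_ : NonNegative x}} .{{_ : NonNegative h}} k →
    expSum (x ℚ.+ h) k ℚ.≤ expSum x k ℚ.+ h ℚ.* expSum (x ℚ.+ h) k
  expSum-+′ x h zero = ℚ.≤-trans (ℚ.≤-reflexive (sym (ℚ.+-identityʳ 1ℚ)))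
    (ℚ.+-monoʳ-≤ 1ℚ (ℚ.≤-trans (ℚ.nonNegative⁻¹ h) (ℚ.≤-reflexive (sym (ℚ.*-identityʳ h)))))
  expSum-+′ x h (suc k) = ℚ.≤-trans (expSum-+ x h k) (ℚ.+-monoʳ-≤ (expSum x (suc k)) (ℚ.*-monoˡ-≤-nonNeg h
    (ℚ.≤-trans (ℚ.≤-reflexive (sym (ℚ.+-identityʳ _))) (ℚ.+-monoʳ-≤ (expSum (x ℚ.+ h) k)
      (ℚ.nonNegative⁻¹ _ {{expTerm-nonNeg (x ℚ.+ h) {{ℚ.nonNeg+nonNeg⇒nonNeg x h}} (suc k)}})))))

  expSum-0 : ∀ k → expSum 0ℚ k ≡ 1ℚ
  expSum-0 zero    = refl
  expSum-0 (suc k) = trans (cong₂ ℚ._+_ (expSum-0 k)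
    (trans (cong (expTerm 0ℚ k ℚ.*_) (ℚ.*-zeroˡ (1 /1+ k))) (ℚ.*-zeroʳ (expTerm 0ℚ k)))) (ℚ.+-identityʳ 1ℚ)

  -- exp (n h) ≤ (1 − h)⁻ⁿ for h = 1 / (e + 1).
  expSum-bound : ∀ e h .{{_ : NonNegative h}} → ℕ→ℚ (suc e) ℚ.* h ≡ 1ℚ → ∀ n k →
    ℕ→ℚ (e ^ n) ℚ.* expSum (ℕ→ℚ n ℚ.* h) k ℚ.≤ ℕ→ℚ (suc e ^ n)
  expSum-bound e h ch≡1 zero    k = ℚ.≤-reflexive (trans (ℚ.*-identityˡ _) (trans (cong (λ x → expSum x k) (ℚ.*-zeroˡ h)) (expSum-0 k)))
  expSum-bound e h ch≡1 (suc n) k = begin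
    ℕ→ℚ (e * e ^ n) ℚ.* expSum (ℕ→ℚ (suc n) ℚ.* h) k
      ≡⟨ cong₂ (λ i y → i ℚ.* expSum y k) (ℕ→ℚ-* e (e ^ n))
           (trans (cong (ℚ._* h) (ℕ→ℚ-suc n)) (trans (ℚ.*-distribʳ-+ h (ℕ→ℚ n) 1ℚ) (cong (x ℚ.+_) (ℚ.*-identityˡ h)))) ⟩
    ℕ→ℚ e ℚ.* p ℚ.* S′
      ≡⟨ solve 4 (λ e p c S → e :* p :* S := p :* ((e :+ con 1ℚ) :* S :+ :- S)) refl (ℕ→ℚ e) p c S′ ⟩
    p ℚ.* ((ℕ→ℚ e ℚ.+ 1ℚ) ℚ.* S′ ℚ.+ ℚ.- S′)
      ≡⟨ cong (λ z → p ℚ.* (z ℚ.* S′ ℚ.+ ℚ.- S′)) (ℕ→ℚ-suc e) ⟨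
    p ℚ.* (c ℚ.* S′ ℚ.+ ℚ.- S′)
      ≤⟨ ℚ.*-monoˡ-≤-nonNeg p {{nonNeg-p}} (ℚ.+-monoˡ-≤ (ℚ.- S′) (ℚ.*-monoˡ-≤-nonNeg c {{nonNeg-c}}
           (expSum-+′ x h {{ℚ.nonNeg*nonNeg⇒nonNeg (ℕ→ℚ n) {{/1+-nonNeg n 0}} h}} k))) ⟩
    p ℚ.* (c ℚ.* (S ℚ.+ h ℚ.* S′) ℚ.+ ℚ.- S′)
      ≡⟨ solve 5 (λ p c h S S′ → p :* (c :* (S :+ h :* S′) :+ :- S′) := c :* (p :* S) :+ p :* (c :* h :* S′ :+ :- S′)) refl p c h S S′ ⟩
    c ℚ.* (p ℚ.* S) ℚ.+ p ℚ.* (c ℚ.* h ℚ.* S′ ℚ.+ ℚ.- S′)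
      ≡⟨ cong (λ z → c ℚ.* (p ℚ.* S) ℚ.+ p ℚ.* (z ℚ.* S′ ℚ.+ ℚ.- S′)) ch≡1 ⟩
    c ℚ.* (p ℚ.* S) ℚ.+ p ℚ.* (1ℚ ℚ.* S′ ℚ.+ ℚ.- S′)
      ≡⟨ solve 4 (λ p c S S′ → c :* (p :* S) :+ p :* (con 1ℚ :* S′ :+ :- S′) := c :* (p :* S)) refl p c S S′ ⟩
    c ℚ.* (p ℚ.* S)
      ≤⟨ ℚ.*-monoˡ-≤-nonNeg c {{nonNeg-c}} (expSum-bound e h ch≡1 n k) ⟩
    c ℚ.* ℕ→ℚ (suc e ^ n)
      ≡⟨ ℕ→ℚ-* (suc e) (suc e ^ n) ⟨
    ℕ→ℚ (suc e * suc e ^ n) ∎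
    where
    open ℚ.≤-Reasoning
    open +-*-Solver
    x  = ℕ→ℚ n ℚ.* h
    c  = ℕ→ℚ (suc e)
    p  = ℕ→ℚ (e ^ n)
    S  = expSum x k
    S′ = expSum (x ℚ.+ h) k
    nonNeg-p : NonNegative p
    nonNeg-p = /1+-nonNeg (e ^ n) 0
    nonNeg-c : NonNegative c
    nonNeg-c = /1+-nonNeg (suc e) 0

  Pr-/1+ : ∀ {A : Set} {P : Pred A 0ℓ} (P? : Decidable P) (Ω : List A) {n} → length Ω ≡ suc n →
    Pr Ω P? ≡ length (filter P? Ω) /1+ n
  Pr-/1+ P? (x ∷ Ω) refl = refl

  ≤/√-/1+ : ∀ {c n C d t} → c * suc t * (c * suc t) * d ≤ C * suc n * (C * suc n) →
    c /1+ n ≤ ℕ→ℚ C ℚ.* 1 /1+ t /√ d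
  ≤/√-/1+ {c} {n} {C} {d} {t} le = subst₂ ℚ._≤_ (sym lhs) (sym rhs)
    (/1+-mono-≤ (c * c * d) (0 + (n + n * suc n) * 1) (C * 1 * (C * 1)) ((t + 0) + (t + 0) * suc (t + 0)) (subst₂ _≤_ (lemma₁ c n d t) (lemma₂ c n C t) le))
    where
    lhs : c /1+ n ℚ.* c /1+ n ℚ.* ℕ→ℚ d ≡ (c * c * d) /1+ (0 + (n + n * suc n) * 1)
    lhs = trans (cong (ℚ._* ℕ→ℚ d) (/1+-* c n c n)) (/1+-* (c * c) (n + n * suc n) d 0)
    rhs : ℕ→ℚ C ℚ.* 1 /1+ t ℚ.* (ℕ→ℚ C ℚ.* 1 /1+ t) ≡ (C * 1 * (C * 1)) /1+ ((t + 0) + (t + 0) * suc (t + 0))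
    rhs = trans (cong (λ z → z ℚ.* z) (/1+-* C 0 1 t)) (/1+-* (C * 1) (t + 0) (C * 1) (t + 0))
    lemma₁ : ∀ c n d t → c * (1 + t) * (c * (1 + t)) * d ≡ c * c * d * (1 + ((t + 0) + (t + 0) * (1 + (t + 0))))
    lemma₁ = solve-∀
    lemma₂ : ∀ c n C t → C * (1 + n) * (C * (1 + n)) ≡ C * 1 * (C * 1) * (1 + (0 + (n + n * (1 + n)) * 1))
    lemma₂ = solve-∀

  ≥1-/1+ : ∀ {g n t} → suc t * suc t * suc n ≤ suc t * suc t * g + suc n →
    g /1+ n ℚ.≥ 1ℚ ℚ.- 1 /1+ t ℚ.* 1 /1+ t
  ≥1-/1+ {g} {n} {t} le = begin
    1ℚ ℚ.- q
      ≤⟨ ℚ.+-monoˡ-≤ (ℚ.- q) one≤ ⟩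
    g /1+ n ℚ.+ q ℚ.- q
      ≡⟨ solve 2 (λ x q → x :+ q :+ :- q := x) refl (g /1+ n) q ⟩
    g /1+ n ∎
    where
    open ℚ.≤-Reasoning
    open +-*-Solver
    q = 1 /1+ t ℚ.* 1 /1+ t
    lemma₁ : ∀ t n → (1 + t) * (1 + t) * (1 + n) ≡ 1 * (1 + ((t + t * (1 + t)) + n * (1 + (t + t * (1 + t)))))
    lemma₁ = solve-∀
    lemma₂ : ∀ t n g → (1 + t) * (1 + t) * g + (1 + n) ≡ (g * (1 + (t + t * (1 + t))) + 1 * 1 * (1 + n)) * 1
    lemma₂ = solve-∀
    one≤ : 1ℚ ℚ.≤ g /1+ n ℚ.+ q
    one≤ = subst (1ℚ ℚ.≤_) (sym (trans (cong (g /1+ n ℚ.+_) (/1+-* 1 t 1 t)) (/1+-+ g n (1 * 1) (t + t * suc t))))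
      (/1+-mono-≤ 1 0 (g * suc (t + t * suc t) + 1 * 1 * suc n) (t + t * suc t + n * suc (t + t * suc t)) (subst₂ _≤_ (lemma₁ t n) (lemma₂ t n g) le))

  log-bound : ∀ e t n → .{{_ : Positive (ℕ→ℚ (suc e))}} → Is⌊ ℕ→ℚ (suc e) ·log t ⌋ n →
    e ^ suc n * t ≤ suc e ^ suc n
  log-bound e t n (_ , k , large) = subst₂ _≤_ (*-identityʳ _) (*-identityʳ _)
    (/1+-cancel-≤ (e ^ suc n * t) 0 (suc e ^ suc n) 0 (begin
      ℕ→ℚ (e ^ suc n * t)
        ≡⟨ ℕ→ℚ-* (e ^ suc n) t ⟩
      ℕ→ℚ (e ^ suc n) ℚ.* ℕ→ℚ t
        ≤⟨ ℚ.*-monoˡ-≤-nonNeg (ℕ→ℚ (e ^ suc n)) {{/1+-nonNeg (e ^ suc n) 0}} (ℚ.<⇒≤ large) ⟩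
      ℕ→ℚ (e ^ suc n) ℚ.* expSum (ℕ→ℚ (suc n) ℚ.* h) k
        ≤⟨ expSum-bound e h {{h≥0}} (ℚ.*-inverseʳ (ℕ→ℚ (suc e)) {{ℚ.pos⇒nonZero (ℕ→ℚ (suc e))}}) (suc n) k ⟩
      ℕ→ℚ (suc e ^ suc n) ∎))
    where
    open ℚ.≤-Reasoning
    h = (ℚ.1/ ℕ→ℚ (suc e)) {{ℚ.pos⇒nonZero (ℕ→ℚ (suc e))}}
    h≥0 : NonNegative h
    h≥0 = ℚ.pos⇒nonNeg h {{ℚ.1/pos⇒pos (ℕ→ℚ (suc e))}}

  bernoulli : ∀ e n → suc e ^ n * e ≤ e ^ n * e + n * suc e ^ n
  bernoulli e zero    = m≤m+n _ _
  bernoulli e (suc n) = begin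
    suc e * suc e ^ n * e
      ≡⟨ *-assoc (suc e) (suc e ^ n) e ⟩
    suc e * (suc e ^ n * e)
      ≤⟨ *-monoʳ-≤ (suc e) (bernoulli e n) ⟩
    suc e * (e ^ n * e + n * suc e ^ n)
      ≡⟨ lemma e n (e ^ n) (suc e ^ n) ⟩
    e ^ n * e + (e * e ^ n * e + n * (suc e * suc e ^ n))
      ≤⟨ +-monoˡ-≤ _ (≤-trans (*-monoˡ-≤ e (^-monoˡ-≤ n (n≤1+n e))) (≤-trans (*-monoʳ-≤ (suc e ^ n) (n≤1+n e)) (≤-reflexive (*-comm (suc e ^ n) (suc e))))) ⟩
    suc e * suc e ^ n + (e * e ^ n * e + n * (suc e * suc e ^ n))
      ≡⟨ lemma′ (suc e * suc e ^ n) (e * e ^ n * e) n ⟩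
    e * e ^ n * e + suc n * (suc e * suc e ^ n) ∎
    where
    open ≤-Reasoning
    lemma : ∀ e n p q → (1 + e) * (p * e + n * q) ≡ p * e + (e * p * e + n * ((1 + e) * q))
    lemma = solve-∀
    lemma′ : ∀ x y n → x + (y + n * x) ≡ y + (1 + n) * x
    lemma′ = solve-∀

  [1+2n]^n≤2*[2n]^n : ∀ n .{{_ : NonZero n}} → suc (2 * n) ^ n ≤ 2 * (2 * n) ^ n
  [1+2n]^n≤2*[2n]^n n = *-cancelˡ-≤ n (+-cancelʳ-≤ (n * suc (2 * n) ^ n) _ _ (begin
    n * suc (2 * n) ^ n + n * suc (2 * n) ^ n
      ≡⟨ lemma n (suc (2 * n) ^ n) ⟩
    suc (2 * n) ^ n * (2 * n)
      ≤⟨ bernoulli (2 * n) n ⟩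
    (2 * n) ^ n * (2 * n) + n * suc (2 * n) ^ n
      ≡⟨ cong (_+ n * suc (2 * n) ^ n) (lemma′ n ((2 * n) ^ n)) ⟩
    n * (2 * (2 * n) ^ n) + n * suc (2 * n) ^ n ∎))
    where
    open ≤-Reasoning
    lemma : ∀ n p → n * p + n * p ≡ p * (2 * n)
    lemma = solve-∀
    lemma′ : ∀ n p → p * (2 * n) ≡ n * (2 * p)
    lemma′ = solve-∀

  power-bound : ∀ A .{{_ : NonZero A}} q n t → let e = 2 * (16 * A) in
    2 ≤ t → n ≤ 8 * suc q → e ^ n * t ≤ suc e ^ n → t ^ A ≤ 2 ^ q
  power-bound A q n t 2≤t n≤ e^n*t≤ = *-cancelˡ-≤ 2 (begin
    2 * t ^ A
      ≤⟨ *-monoˡ-≤ (t ^ A) (≤-trans (n<2^n 1) (≤-trans (^-monoʳ-≤ 2 (>-nonZero⁻¹ A)) (^-monoˡ-≤ A 2≤t))) ⟩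
    t ^ A * t ^ A
      ≡⟨ ^-distribˡ-+-* t A A ⟨
    t ^ (A + A)
      ≤⟨ *-cancelˡ-≤ (e ^ (16 * A * suc q)) {{m^n≢0 e (16 * A * suc q) {{e≢0}}}} amplified ⟩
    2 ^ suc q ∎)
    where
    open ≤-Reasoning
    e = 2 * (16 * A)
    16A≢0 : NonZero (16 * A)
    16A≢0 = m*n≢0 16 A
    e≢0 : NonZero e
    e≢0 = m*n≢0 2 (16 * A) {{_}} {{16A≢0}}
    raised : e ^ (8 * suc q) * t ≤ suc e ^ (8 * suc q)
    raised = begin
      e ^ (8 * suc q) * t
        ≡⟨ cong (λ i → e ^ i * t) (m∸n+n≡m n≤) ⟨
      e ^ (8 * suc q ∸ n + n) * t
        ≡⟨ trans (cong (_* t) (^-distribˡ-+-* e (8 * suc q ∸ n) n)) (*-assoc (e ^ (8 * suc q ∸ n)) _ t) ⟩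
      e ^ (8 * suc q ∸ n) * (e ^ n * t)
        ≤⟨ *-mono-≤ (^-monoˡ-≤ (8 * suc q ∸ n) (n≤1+n e)) e^n*t≤ ⟩
      suc e ^ (8 * suc q ∸ n) * suc e ^ n
        ≡⟨ ^-distribˡ-+-* (suc e) (8 * suc q ∸ n) n ⟨
      suc e ^ (8 * suc q ∸ n + n)
        ≡⟨ cong (suc e ^_) (m∸n+n≡m n≤) ⟩
      suc e ^ (8 * suc q) ∎
    exponent : ∀ x → (x ^ (8 * suc q)) ^ (A + A) ≡ x ^ (16 * A * suc q)
    exponent x = trans (^-*-assoc x (8 * suc q) (A + A)) (cong (x ^_) (lemma A q))
      where
      lemma : ∀ A q → 8 * (1 + q) * (A + A) ≡ 16 * A * (1 + q)
      lemma = solve-∀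
    amplified : e ^ (16 * A * suc q) * t ^ (A + A) ≤ e ^ (16 * A * suc q) * 2 ^ suc q
    amplified = begin
      e ^ (16 * A * suc q) * t ^ (A + A)
        ≡⟨ cong (_* t ^ (A + A)) (exponent e) ⟨
      (e ^ (8 * suc q)) ^ (A + A) * t ^ (A + A)
        ≡⟨ ^-distribʳ-* (A + A) (e ^ (8 * suc q)) t ⟨
      (e ^ (8 * suc q) * t) ^ (A + A)
        ≤⟨ ^-monoˡ-≤ (A + A) raised ⟩
      (suc e ^ (8 * suc q)) ^ (A + A)
        ≡⟨ trans (exponent (suc e)) (sym (^-*-assoc (suc e) (16 * A) (suc q))) ⟩
      (suc e ^ (16 * A)) ^ suc q
        ≤⟨ ^-monoˡ-≤ (suc q) ([1+2n]^n≤2*[2n]^n (16 * A) {{16A≢0}}) ⟩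
      (2 * e ^ (16 * A)) ^ suc q
        ≡⟨ ^-distribʳ-* (suc q) 2 (e ^ (16 * A)) ⟩
      2 ^ suc q * (e ^ (16 * A)) ^ suc q
        ≡⟨ cong (2 ^ suc q *_) (^-*-assoc e (16 * A) (suc q)) ⟩
      2 ^ suc q * e ^ (16 * A * suc q)
        ≡⟨ *-comm (2 ^ suc q) _ ⟩
      e ^ (16 * A * suc q) * 2 ^ suc q ∎

  m<n+[m/n]*n : ∀ m n .{{_ : NonZero n}} → m < n + m / n * n
  m<n+[m/n]*n m n = ≤-<-trans (≤-reflexive (m≡m%n+[m/n]*n m n)) (+-monoˡ-< (m / n * n) (m%n<n m n))

  ⌊√_⌋ : ∀ n → ∃ λ s → s * s ≤ n × n < suc s * suc s
  ⌊√ zero ⌋  = 0 , z≤n , s≤s z≤n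
  ⌊√ suc n ⌋ with ⌊√ n ⌋
  ... | s , s²≤n , n<[1+s]² with suc n <? suc s * suc s
  ... | yes lt = s , ≤-trans s²≤n (n≤1+n n) , lt
  ... | no ≮   = suc s , ≮⇒≥ ≮ , ≤-<-trans n<[1+s]² (≤-trans (m<m+n _ (s≤s z≤n)) (≤-reflexive (lemma s)))
    where
    lemma : ∀ s → (1 + s) * (1 + s) + (1 + (s + s + 2)) ≡ (2 + s) * (2 + s)
    lemma = solve-∀

  -- The ninth power of 4 makes 4ᵈ t² ≤ K^(q + 1) when d ≤ 8 (q + 1) and t ≤ 2^q.
  -- K is opaque to keep Agda from unfolding products with it.
  opaque
    K : ℕ
    K = 4 ^ 9

    4^9n≤K^n : ∀ n → 4 ^ (9 * n) ≤ K ^ n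
    4^9n≤K^n n = ≤-reflexive (sym (^-*-assoc 4 9 n))

    instance
      K≢0 : NonZero K
      K≢0 = _

  M : ℕ
  M = 2 * K * (3 * (8 * K))

  length-choices : ∀ d → length (choices d) ≡ 2 ^ d
  length-choices zero    = refl
  length-choices (suc d) = begin
    length (map (Fin.zero ∷_) (choices d) ++ (map (Fin.suc Fin.zero ∷_) (choices d) ++ []))
      ≡⟨ length-++ (map (Fin.zero ∷_) (choices d)) ⟩
    length (map (Fin.zero ∷_) (choices d)) + length (map (Fin.suc Fin.zero ∷_) (choices d) ++ [])
      ≡⟨ cong₂ _+_ (trans (length-map _ (choices d)) (length-choices d))
           (trans (length-++ (map (Fin.suc Fin.zero ∷_) (choices d))) (cong (_+ 0) (trans (length-map _ (choices d)) (length-choices d)))) ⟩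
    2 ^ suc d ∎
    where
    open ≡-Reasoning

  spread-from-count : ∀ C t d a →
    (∀ n → let c = ∑ (choices d) (λ j → 𝟙 (Vec.sum (zipWith lookup a j) ≟ n)) in
      c * suc t * (c * suc t) * d ≤ C * 2 ^ d * (C * 2 ^ d)) →
    Spread (ℕ→ℚ C) (suc t) d a
  spread-from-count C t d a bound S = subst (λ p → p ≤ ℕ→ℚ C ℚ.* 1 /1+ t /√ d)
    (sym (Pr-/1+ S? (choices d) (trans (length-choices d) (sym (suc-pred (2 ^ d) {{m^n≢0 2 d}})))))
    (≤/√-/1+ {length (filter S? (choices d))} {pred (2 ^ d)} {C} {d} {t}
      (subst (λ N → let c = length (filter S? (choices d)) in c * suc t * (c * suc t) * d ≤ C * N * (C * N))
        (sym (suc-pred (2 ^ d) {{m^n≢0 2 d}})) (count≤ S)))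
    where
    S? : Decidable (λ j → Q a j ≡ S)
    S? j = Q a j ℤ.≟ S
    count≤ : ∀ S → let c = length (filter (λ j → Q a j ℤ.≟ S) (choices d)) in
      c * suc t * (c * suc t) * d ≤ C * 2 ^ d * (C * 2 ^ d)
    count≤ (ℤ.+ n) = subst (λ c → c * suc t * (c * suc t) * d ≤ C * 2 ^ d * (C * 2 ^ d))
      (sym (trans (length-filter-∑ (λ j → Q a j ℤ.≟ ℤ.+ n) (choices d)) (∑-cong (choices d) λ j →
        𝟙-cong (Q a j ℤ.≟ ℤ.+ n) (Vec.sum (zipWith lookup a j) ≟ n) ℤ.+-injective (λ sum≡n → cong (λ i → ℤ.+ i) sum≡n)))) (bound n)
    count≤ S@(ℤ.-[1+ _ ]) = subst (λ c → c * suc t * (c * suc t) * d ≤ C * 2 ^ d * (C * 2 ^ d))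
      (sym (trans (length-filter-∑ (λ j → Q a j ℤ.≟ S) (choices d)) (∑-zero (choices d) λ j →
        𝟙-no (Q a j ℤ.≟ S) λ ()))) z≤n

  e : ℕ
  e = 2 * (16 * K)

  C : ℕ
  C = 16 * suc M

  C₁ C₂ : ℚ
  C₁ = ℕ→ℚ (suc e)
  C₂ = ℕ→ℚ C

  C₁>0 : Positive C₁
  C₁>0 = ℚ.normalize-pos (suc e) 1

  C₂>0 : Positive C₂
  C₂>0 = ℚ.normalize-pos C 1 {{_}} {{m*n≢0 16 (suc M)}}

  spread-probability : ∀ t d f .{{_ : NonZero t}} .{{_ : NonZero d}} → 30 * d ≤ t →
    Is⌊_·log_⌋ C₁ {{C₁>0}} t f → f ≤ d →
    Pr (disjointPairs t d) (spread? C₂ t d) ℚ.≥ 1ℚ ℚ.- (ℤ.+ 1 ℚ./ t) ℚ.* (ℤ.+ 1 ℚ./ t)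
  spread-probability t@(suc t₀) d f 30d≤t f=⌊⌋ f≤d = subst (ℚ._≥ 1ℚ ℚ.- 1 /1+ t₀ ℚ.* 1 /1+ t₀)
    (sym (Pr-/1+ S? Ω {pred (length Ω)} (sym (suc-pred (length Ω) {{Ω≢0}}))))
    (≥1-/1+ {length (filter S? Ω)} {pred (length Ω)} {t₀}
      (subst (λ N → t * t * N ≤ t * t * length (filter S? Ω) + N) (sym (suc-pred (length Ω) {{Ω≢0}}))
        (few-exceptional t δ s K (8 * K) {{K≢0}} {{m*n≢0 8 K}} 4Kδ≤t t≤8Kδ {d} q S? spread 8d≤t 4^d*t²≤)))
    where
    open ≤-Reasoning
    instance
      4K≢0 : NonZero (4 * K)
      4K≢0 = m*n≢0 4 K
    q = d / 8
    s = proj₁ ⌊√ q ⌋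
    δ = t / (4 * K)
    Ω = disjointPairs t d
    S? = spread? C₂ t d
    1≤d : 1 ≤ d
    1≤d = >-nonZero⁻¹ d
    8q≤d : 8 * q ≤ d
    8q≤d = ≤-trans (≤-reflexive (*-comm 8 q)) (m/n*n≤m d 8)
    d<8[1+q] : d < 8 * suc q
    d<8[1+q] = ≤-trans (m<n+[m/n]*n d 8) (≤-reflexive (*-comm (suc q) 8))
    8d≤t : 8 * d ≤ t
    8d≤t = ≤-trans (*-monoˡ-≤ d (≤ᵇ⇒≤ 8 30 _)) 30d≤t
    2≤t : 2 ≤ t
    2≤t = ≤-trans (*-mono-≤ {2} {30} {1} {d} (≤ᵇ⇒≤ 2 30 _) 1≤d) 30d≤t
    t^K≤2^q : t ^ K ≤ 2 ^ q
    t^K≤2^q = power-bound K q (suc f) t 2≤t (≤-trans (s≤s f≤d) d<8[1+q]) (log-bound e t f {{C₁>0}} f=⌊⌋)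
    t≤2^q : t ≤ 2 ^ q
    t≤2^q = ≤-trans (≤-trans (≤-reflexive (sym (*-identityʳ t))) (^-monoʳ-≤ t (>-nonZero⁻¹ K))) t^K≤2^q
    K≤q : K ≤ q
    K≤q = ≮⇒≥ λ q<K → <⇒≱ (^-monoʳ-< 2 (s≤s (s≤s z≤n)) q<K) (≤-trans (^-monoˡ-≤ K 2≤t) t^K≤2^q)
    4K≤t : 4 * K ≤ t
    4K≤t = begin
      4 * K           ≤⟨ *-mono-≤ (≤ᵇ⇒≤ 4 (30 * 8) _) K≤q ⟩
      30 * 8 * q      ≡⟨ *-assoc 30 8 q ⟩
      30 * (8 * q)    ≤⟨ *-monoʳ-≤ 30 8q≤d ⟩
      30 * d          ≤⟨ 30d≤t ⟩
      t               ∎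
    4Kδ≤t : 4 * K * δ ≤ t
    4Kδ≤t = ≤-trans (≤-reflexive (*-comm (4 * K) δ)) (m/n*n≤m t (4 * K))
    1≤δ : 1 ≤ δ
    1≤δ = m≥n⇒m/n>0 4K≤t
    t≤8Kδ : t ≤ 8 * K * δ
    t≤8Kδ = begin
      t                         ≤⟨ <⇒≤ (m<n+[m/n]*n t (4 * K)) ⟩
      4 * K + δ * (4 * K)       ≤⟨ +-monoˡ-≤ _ (≤-trans (≤-reflexive (sym (*-identityˡ (4 * K)))) (*-monoˡ-≤ (4 * K) 1≤δ)) ⟩
      δ * (4 * K) + δ * (4 * K) ≡⟨ lemma δ K ⟩
      8 * K * δ                 ∎
      where
      lemma : ∀ δ K → δ * (4 * K) + δ * (4 * K) ≡ 8 * K * δ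
      lemma = solve-∀
    s²≤q : s * s ≤ q
    s²≤q = proj₁ (proj₂ ⌊√ q ⌋)
    q<[1+s]² : q < suc s * suc s
    q<[1+s]² = proj₂ (proj₂ ⌊√ q ⌋)
    1≤q : 1 ≤ q
    1≤q = ≤-trans (>-nonZero⁻¹ K) K≤q
    1≤s : 1 ≤ s
    1≤s = ≮⇒≥ λ s<1 → <⇒≱ q<[1+s]² (≤-trans (≤-reflexive (cong (λ i → suc i * suc i) (n<1⇒n≡0 s<1))) 1≤q)
    s≤q : s ≤ q
    s≤q = ≤-trans (≤-trans (≤-reflexive (sym (*-identityʳ s))) (*-monoʳ-≤ s 1≤s)) s²≤q
    ts≤ : t * s ≤ 2 ^ (2 * q)
    ts≤ = begin
      t * s             ≤⟨ *-mono-≤ t≤2^q (≤-trans s≤q (<⇒≤ (n<2^n q))) ⟩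
      2 ^ q * 2 ^ q     ≡⟨ ^-distribˡ-+-* 2 q q ⟨
      2 ^ (q + q)       ≡⟨ cong (λ i → 2 ^ (q + i)) (+-identityʳ q) ⟨
      2 ^ (2 * q)       ∎
    d≤64s² : d ≤ 64 * (s * s)
    d≤64s² = begin
      d                         ≤⟨ <⇒≤ d<8[1+q] ⟩
      8 * suc q                 ≤⟨ *-monoʳ-≤ 8 q<[1+s]² ⟩
      8 * (suc s * suc s)       ≤⟨ *-monoʳ-≤ 8 (*-mono-≤ (+-monoˡ-≤ s 1≤s) (+-monoˡ-≤ s 1≤s)) ⟩
      8 * ((s + s) * (s + s))   ≡⟨ lemma s ⟩
      32 * (s * s)              ≤⟨ *-monoˡ-≤ (s * s) (≤ᵇ⇒≤ 32 64 _) ⟩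
      64 * (s * s)              ∎
      where
      lemma : ∀ s → 8 * ((s + s) * (s + s)) ≡ 32 * (s * s)
      lemma = solve-∀
    4^d*t²≤ : 4 ^ d * (t * t) ≤ K ^ suc q
    4^d*t²≤ = begin
      4 ^ d * (t * t)
        ≤⟨ *-mono-≤ (^-monoʳ-≤ 4 (<⇒≤ d<8[1+q])) (*-mono-≤ t≤2^q t≤2^q) ⟩
      4 ^ (8 * suc q) * (2 ^ q * 2 ^ q)
        ≡⟨ cong (4 ^ (8 * suc q) *_) (^-distribʳ-* q 2 2) ⟨
      4 ^ (8 * suc q) * 4 ^ q
        ≤⟨ *-monoʳ-≤ (4 ^ (8 * suc q)) (^-monoʳ-≤ 4 (n≤1+n q)) ⟩
      4 ^ (8 * suc q) * 4 ^ suc q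
        ≡⟨ ^-distribˡ-+-* 4 (8 * suc q) (suc q) ⟨
      4 ^ (8 * suc q + suc q)
        ≡⟨ cong (4 ^_) (lemma q) ⟩
      4 ^ (9 * suc q)
        ≤⟨ 4^9n≤K^n (suc q) ⟩
      K ^ suc q ∎
      where
      lemma : ∀ q → 8 * (1 + q) + (1 + q) ≡ 9 * (1 + q)
      lemma = solve-∀
    1≤Ω : 1 ≤ length Ω
    1≤Ω = ≮⇒≥ λ Ω<1 → <⇒≱ (m^n>0 (t * t) d) (≤-trans (many-disjointPairs t d 8d≤t)
      (≤-reflexive (trans (cong (2 ^ d *_) (n<1⇒n≡0 Ω<1)) (*-zeroʳ (2 ^ d)))))
    Ω≢0 : NonZero (length Ω)
    Ω≢0 = >-nonZero 1≤Ω
    spread : ∀ a → totalBad t δ s M a ≤ q → Spread C₂ t d a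
    spread a bad≤q = spread-from-count C t₀ d a λ n → begin
      count a n * t * (count a n * t) * d
        ≤⟨ *-monoʳ-≤ (count a n * t * (count a n * t)) d≤64s² ⟩
      count a n * t * (count a n * t) * (64 * (s * s))
        ≡⟨ lemma₁ (count a n) t s ⟩
      64 * (t * s * count a n * (t * s * count a n))
        ≤⟨ *-monoʳ-≤ 64 (*-mono-≤ (bound n) (bound n)) ⟩
      64 * (2 * suc M * 2 ^ d * (2 * suc M * 2 ^ d))
        ≡⟨ lemma₂ (suc M) (2 ^ d) ⟩
      16 * suc M * 2 ^ d * (16 * suc M * 2 ^ d) ∎
      where
      count : Pairs d → ℕ → ℕ
      count a n = ∑ (choices d) (λ j → 𝟙 (Vec.sum (zipWith lookup a j) ≟ n))
      bound : ∀ n → t * s * count a n ≤ 2 * suc M * 2 ^ d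
      bound = choices-bound t δ s M q a 8q≤d s²≤q bad≤q ts≤
      lemma₁ : ∀ c t s → c * t * (c * t) * (64 * (s * s)) ≡ 64 * (t * s * c * (t * s * c))
      lemma₁ = solve-∀
      lemma₂ : ∀ m p → 64 * (2 * m * p * (2 * m * p)) ≡ 16 * m * p * (16 * m * p)
      lemma₂ = solve-∀

open import Defs
open import Data.Integer.Base using (+_)
open import Data.Nat.Base as ℕ using (ℕ; NonZero)
open import Data.Product.Base using (Σ-syntax; _×_; _,_)
open import Data.Rational.Base using (ℚ; Positive; 1ℚ; _-_; _*_; _/_; _≥_)

lemma2p3 : Σ[ C₁ ∈ ℚ ] Σ[ C₂ ∈ ℚ ] Σ[ pos₁ ∈ Positive C₁ ]
    Positive C₂ ×
    (∀ (t d f : ℕ) .{{_ : NonZero t}} .{{_ : NonZero d}} →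
    30 ℕ.* d ℕ.≤ t →
    Is⌊_·log_⌋ C₁ {{pos₁}} t f → f ℕ.≤ d →
    Pr (disjointPairs t d) (spread? C₂ t d) ≥ 1ℚ - (+ 1 / t) * (+ 1 / t))
lemma2p3 = C₁ , C₂ , C₁>0 , C₂>0 , spread-probability
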